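{- Let $q$ be a natural number and $k$ an integer with $\gcd(k,q)=1$. If $k/q$ is the value of a normalized Dedekind sum, i.e. $k/q=S(a,b)$ for some $a\in\mathbb{Z}$, $b\in\mathbb{N}$ with $\gcd(a,b)=1$, then for every integer $k'$ with $k'\equiv k \pmod{(q^2-1)q}$, the number $k'/q$ is also the value of a normalized Dedekind sum.
   Context: For $x\in\mathbb{R}$ let $((x))=x-\lfloor x\rfloor-1/2$ if $x\notin\mathbb{Z}$ and $((x))=0$ if $x\in\mathbb{Z}$. For $a\in\mathbb{Z}$, $b\in\mathbb{N}$ with $\gcd(a,b)=1$, the classical Dedekind sum is $s(a,b)=\sum_{j=1}^{b}((j/b))((aj/b))$, and the normalized Dedekind sum is $S(a,b)=12\,s(a,b)$. A rational number is "the value of a normalized Dedekind sum" if it equals $S(a,b)$ for some such $a,b$. -}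

module Defs where

open import Data.Bool using (if_then_else_)
open import Data.Nat as ℕ using (ℕ; suc; _≡ᵇ_)
open import Data.Nat.Coprimality using (Coprime)
open import Data.Integer as ℤ using (ℤ; +_; ∣_∣)
open import Data.Rational using (ℚ; _/_; ↧ₙ_; floor; _-_; _*_; _+_; ½; 0ℚ; 1ℚ)
open import Data.Product using (Σ; _×_)
open import Relation.Binary.PropositionalEquality using (_≡_)

-- sawtooth ((x)) = x - ⌊x⌋ - 1/2 if x ∉ ℤ, and 0 if x ∈ ℤ
-- (a rational x is an integer iff its reduced denominator is 1)
saw : ℚ → ℚ
saw x = if ↧ₙ x ≡ᵇ 1 then 0ℚ else (x - (floor x / 1)) - ½

sumFrom1 : ℕ → (ℕ → ℚ) → ℚ
sumFrom1 ℕ.zero f = 0ℚ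
sumFrom1 (suc n) f = sumFrom1 n f + f (suc n)

s : ℤ → (b : ℕ) → .{{_ : ℕ.NonZero b}} → ℚ
s a b = sumFrom1 b (λ j → saw (+ j / b) * saw ((a ℤ.* + j) / b))

S : ℤ → (b : ℕ) → .{{_ : ℕ.NonZero b}} → ℚ
S a b = + 12 / 1 * s a b

IsDedekindValue : ℚ → Set
IsDedekindValue r =
  Σ ℤ λ a → Σ ℕ λ b → Σ (ℕ.NonZero b) λ nz →
    Coprime ∣ a ∣ b × r ≡ S a b {{nz}}

{-# OPTIONS --safe #-}

-- Write ((x)) for the sawtooth function and s(x, y; c) = Σ_{j mod c} ((xj/c))((yj/c)).
-- Rademacher's three-term relation, for pairwise coprime a, b, c, is
--   s(b, c; a) + s(c, a; b) + s(a, b; c) = −1/4 + (a² + b² + c²) / (12abc).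
-- It follows by summing ((x)) + ((y)) + ((z)) ∈ {0, ±1/2}, squared, over x = h/a − i/b,
-- y = i/b − j/c, z = j/c − h/a: the mixed terms give the Dedekind sums by the distribution
-- relation of the sawtooth, the squares are elementary by the Chinese remainder theorem.
-- Its case c = 1 shows that S(a,b) = k/q in lowest terms forces b = q t with t m = a² + 1 and
-- gcd(m, q) = 1.  Applying it to (1, a, q t) and to (q, m, a) then gives
--   S(a, q t) = a (q² − 1) / (q m) + 12 s(a, m; q) + 12 s(q, a; m).
-- The last two terms only depend on a modulo q m, so replacing a by a + n q m (and t by
-- ((a + n q m)² + 1) / m) adds n (q² − 1) to the value.  Negative n is reached by S(−a,b) = −S(a,b).
module Submission where

open import Defs
open import Data.Fin using (Fin; toℕ; fromℕ<)
open import Data.Fin.Permutation using (Permutation′; permutation; _⟨$⟩ʳ_)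
open import Data.Fin.Properties using (toℕ<n; toℕ-fromℕ<; toℕ-injective)
open import Data.Integer as ℤ using (ℤ; +_; -[1+_]; ∣_∣; _+_; _*_; -_; _-_; 0ℤ; 1ℤ)
open import Data.Integer.DivMod using (_%ℕ_; _/ℕ_; n%ℕd<d; a≡a%ℕn+[a/ℕn]*n)
open import Data.Integer.Divisibility using (_∣_)
open import Data.Integer.Divisibility.Signed using (∣ᵤ⇒∣; divides)
import Data.Integer.GCD as ℤ
open import Data.Integer.Properties
open import Algebra.Properties.CommutativeMonoid.Sum +-0-commutativeMonoid using (sum; sum-permute; sum-cong-≗)
open import Data.Integer.Tactic.RingSolver using (solve-∀)
open import Data.List using (List; []; _∷_; foldr)
open import Data.Nat as ℕ using (ℕ; zero; suc; NonZero; z≤n; s≤s)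
open import Data.Nat.Coprimality using (Coprime; coprime-Bézout)
import Data.Nat.Divisibility as ℕ
open import Data.Nat.GCD using (module Bézout)
import Data.Nat.Properties as ℕ
open import Data.Product using (∃; ∃₂; Σ; _,_; _×_; proj₁; proj₂)
open import Data.Rational as ℚ using (mkℚ; _/_; ↥_; ↧_; toℚᵘ; ½; floor)
open import Data.Rational.Properties using (toℚᵘ-homo-+; toℚᵘ-homo-*; toℚᵘ-homo‿-; toℚᵘ-fromℚᵘ; toℚᵘ-injective; toℚᵘ-cong; ↥-/; ↧-/)
open import Data.Rational.Unnormalised as ℚᵘ using (mkℚᵘ; *≡*; _≃_)
import Data.Rational.Unnormalised.Properties as ℚᵘ
open import Data.Sum using (_⊎_; inj₁; inj₂)
open import Function using (_∘_)
open import Relation.Binary.PropositionalEquality using (_≡_; _≢_; refl; sym; trans; cong; cong₂; subst; module ≡-Reasoning)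
open import Relation.Nullary using (yes; no; contradiction)
open import Relation.Nullary.Decidable using (recompute)
open ≡-Reasoning

-- Finite sums

-- The two applications combine because they share a term: t m = a² + 1 gives m q t ≡ q modulo a, so
-- rescaling the summation variable by the unit m turns s(1, q t; a) into s(m, q; a). Once it is
-- eliminated, only sums modulo q and m remain, and both moduli stay fixed while a and t move.
-- Lowest terms enter twice: they force q to divide b, and they make m, which is k a modulo q, prime
-- to q, as the relation for (q, m, a) requires. All of this takes place in ℤ. The sawtooth is
-- scaled to 2c((x/c)), each relation is multiplied by its common denominator, and rationals appear
-- only when the result is carried back to `S`. The exceptional value 0 of the sawtooth at integers
-- is tracked by an indicator, and the corrections it causes are counts of triples (h, i, j).

∑ : ℕ → (ℕ → ℤ) → ℤ
∑ zero    f = 0ℤ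
∑ (suc n) f = ∑ n f + f n

∑-cong< : ∀ n {f g} → (∀ i → i ℕ.< n → f i ≡ g i) → ∑ n f ≡ ∑ n g
∑-cong< zero    f≡g = refl
∑-cong< (suc n) f≡g =
  cong₂ _+_ (∑-cong< n λ i i<n → f≡g i (ℕ.m<n⇒m<1+n i<n)) (f≡g n (ℕ.n<1+n n))

∑-cong : ∀ n {f g} → (∀ i → f i ≡ g i) → ∑ n f ≡ ∑ n g
∑-cong n f≡g = ∑-cong< n λ i _ → f≡g i

∑-const : ∀ n c → ∑ n (λ _ → c) ≡ + n * c
∑-const zero    c = sym (*-zeroˡ c)
∑-const (suc n) c = begin
  ∑ n (λ _ → c) + c  ≡⟨ cong (_+ c) (∑-const n c) ⟩
  + n * c + c        ≡⟨ +-comm (+ n * c) c ⟩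
  c + + n * c        ≡⟨ sym (suc-* (+ n) c) ⟩
  + suc n * c        ∎

∑-zero : ∀ n {f} → (∀ i → i ℕ.< n → f i ≡ 0ℤ) → ∑ n f ≡ 0ℤ
∑-zero n f≡0 = trans (∑-cong< n f≡0) (trans (∑-const n 0ℤ) (*-zeroʳ (+ n)))

∑-+ : ∀ n f g → ∑ n (λ i → f i + g i) ≡ ∑ n f + ∑ n g
∑-+ zero    f g = refl
∑-+ (suc n) f g = begin
  ∑ n (λ i → f i + g i) + (f n + g n)  ≡⟨ cong (_+ (f n + g n)) (∑-+ n f g) ⟩
  ∑ n f + ∑ n g + (f n + g n)          ≡⟨ interchange (∑ n f) (∑ n g) (f n) (g n) ⟩
  (∑ n f + f n) + (∑ n g + g n)        ∎
  where
  interchange : ∀ a b c d → a + b + (c + d) ≡ (a + c) + (b + d)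
  interchange = solve-∀

∑-*ˡ : ∀ n c f → ∑ n (λ i → c * f i) ≡ c * ∑ n f
∑-*ˡ zero    c f = sym (*-zeroʳ c)
∑-*ˡ (suc n) c f =
  trans (cong (_+ c * f n) (∑-*ˡ n c f)) (sym (*-distribˡ-+ c (∑ n f) (f n)))

∑-*ʳ : ∀ n c f → ∑ n (λ i → f i * c) ≡ ∑ n f * c
∑-*ʳ n c f = begin
  ∑ n (λ i → f i * c)  ≡⟨ ∑-cong n (λ i → *-comm (f i) c) ⟩
  ∑ n (λ i → c * f i)  ≡⟨ ∑-*ˡ n c f ⟩
  c * ∑ n f            ≡⟨ *-comm c (∑ n f) ⟩
  ∑ n f * c            ∎

∑-neg : ∀ n f → ∑ n (λ i → - f i) ≡ - ∑ n f
∑-neg zero    f = refl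
∑-neg (suc n) f =
  trans (cong (_+ - f n) (∑-neg n f)) (sym (neg-distrib-+ (∑ n f) (f n)))

∑-comm : ∀ m n (f : ℕ → ℕ → ℤ) →
  ∑ m (λ i → ∑ n (λ j → f i j)) ≡ ∑ n (λ j → ∑ m (λ i → f i j))
∑-comm zero    n f = sym (∑-zero n λ _ _ → refl)
∑-comm (suc m) n f = begin
  ∑ m (λ i → ∑ n (f i)) + ∑ n (f m)              ≡⟨ cong (_+ ∑ n (f m)) (∑-comm m n f) ⟩
  ∑ n (λ j → ∑ m (λ i → f i j)) + ∑ n (f m)      ≡⟨ sym (∑-+ n (λ j → ∑ m (λ i → f i j)) (f m)) ⟩
  ∑ n (λ j → ∑ m (λ i → f i j) + f m j)          ∎

∑-++ : ∀ m n f → ∑ (m ℕ.+ n) f ≡ ∑ m f + ∑ n (λ i → f (m ℕ.+ i))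
∑-++ m zero f rewrite ℕ.+-identityʳ m = sym (+-identityʳ (∑ m f))
∑-++ m (suc n) f rewrite ℕ.+-suc m n =
  trans (cong (_+ f (m ℕ.+ n)) (∑-++ m n f))
        (+-assoc (∑ m f) (∑ n (λ i → f (m ℕ.+ i))) (f (m ℕ.+ n)))

∑-suc : ∀ n f → ∑ (suc n) f ≡ f 0 + ∑ n (f ∘ suc)
∑-suc n f = trans (∑-++ 1 n f) (cong (_+ ∑ n (f ∘ suc)) (+-identityˡ (f 0)))

∑-blocks : ∀ a b f → ∑ (a ℕ.* b) f ≡ ∑ a (λ h → ∑ b (λ i → f (h ℕ.* b ℕ.+ i)))
∑-blocks zero    b f = refl
∑-blocks (suc a) b f = begin
  ∑ (b ℕ.+ a ℕ.* b) f  ≡⟨ cong (λ n → ∑ n f) (ℕ.+-comm b (a ℕ.* b)) ⟩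
  ∑ (a ℕ.* b ℕ.+ b) f  ≡⟨ ∑-++ (a ℕ.* b) b f ⟩
  ∑ (a ℕ.* b) f + ∑ b (λ i → f (a ℕ.* b ℕ.+ i))
    ≡⟨ cong (_+ ∑ b (λ i → f (a ℕ.* b ℕ.+ i))) (∑-blocks a b f) ⟩
  ∑ a (λ h → ∑ b (λ i → f (h ℕ.* b ℕ.+ i))) + ∑ b (λ i → f (a ℕ.* b ℕ.+ i))  ∎

∑≡sum : ∀ n f → ∑ n f ≡ sum {n} (f ∘ toℕ)
∑≡sum zero    f = refl
∑≡sum (suc n) f = trans (∑-suc n f) (cong (λ w → f 0 + w) (∑≡sum n (f ∘ suc)))

-- Residues

-- The junk value rem 0 x = 0 keeps NonZero constraints out of the definitions of σ and δ.
rem : ℕ → ℤ → ℕ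
rem zero    x = 0
rem (suc c) x = x %ℕ suc c

rem< : ∀ c .{{_ : NonZero c}} x → rem c x ℕ.< c
rem< (suc c) x = n%ℕd<d x (suc c)

rem-eq : ∀ c .{{_ : NonZero c}} x → ∃ λ z → x ≡ + rem c x + z * + c
rem-eq (suc c) x = x /ℕ suc c , a≡a%ℕn+[a/ℕn]*n x (suc c)

private
  -- A positive quotient would push r up to c or beyond, and a negative one puts r below s. Used in
  -- both directions, this half gives uniqueness by antisymmetry.
  residue≤ : ∀ {c r s} z → r ℕ.< c → + r ≡ + s + z * + c → r ℕ.≤ s
  residue≤ {c} {r} {s} (+ 0) r<c eq = ℕ.≤-reflexive (+-injective (trans eq (+-identityʳ (+ s))))
  residue≤ {c} {r} {s} (+ suc z) r<c eq = contradiction r<c (ℕ.≤⇒≯ c≤r)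
    where
    r≡ : r ≡ s ℕ.+ suc z ℕ.* c
    r≡ = +-injective (trans eq (cong (λ w → + s + w) (sym (pos-* (suc z) c))))
    c≤r : c ℕ.≤ r
    c≤r = subst (c ℕ.≤_) (sym r≡) (ℕ.≤-trans (ℕ.m≤m+n c (z ℕ.* c)) (ℕ.m≤n+m (suc z ℕ.* c) s))
  residue≤ {c} {r} {s} -[1+ z ] r<c eq = subst (r ℕ.≤_) r+≡ (ℕ.m≤m+n r (suc z ℕ.* c))
    where
    r+≡ : r ℕ.+ suc z ℕ.* c ≡ s
    r+≡ = +-injective (begin
      + r + + (suc z ℕ.* c)                       ≡⟨ cong₂ _+_ eq (pos-* (suc z) c) ⟩
      + s + -[1+ z ] * + c + + suc z * + c        ≡⟨ cancel (+ s) (+ suc z) (+ c) ⟩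
      + s                                         ∎)
      where
      cancel : ∀ s z c → s + - z * c + z * c ≡ s
      cancel = solve-∀

residue-unique : ∀ {c r s} z → r ℕ.< c → s ℕ.< c → + r ≡ + s + z * + c → r ≡ s
residue-unique {c} {r} {s} z r<c s<c eq =
  ℕ.≤-antisym (residue≤ z r<c eq) (residue≤ (- z) s<c (begin
    + s                            ≡⟨ back (+ s) z (+ c) ⟩
    + s + z * + c + - z * + c      ≡⟨ cong (_+ - z * + c) (sym eq) ⟩
    + r + - z * + c                ∎))
  where
  back : ∀ s z c → s ≡ s + z * c + - z * c
  back = solve-∀

rem-unique : ∀ {c} .{{_ : NonZero c}} {x r} z → r ℕ.< c → x ≡ + r + z * + c → rem c x ≡ r
rem-unique {c} {x} {r} z r<c eq with rem-eq c x
... | z′ , eq′ = residue-unique (z - z′) (rem< c x) r<c (begin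
  + rem c x                              ≡⟨ lem₁ (+ rem c x) z′ (+ c) ⟩
  (+ rem c x + z′ * + c) - z′ * + c      ≡⟨ cong (_- z′ * + c) (trans (sym eq′) eq) ⟩
  (+ r + z * + c) - z′ * + c             ≡⟨ lem₂ (+ r) z z′ (+ c) ⟩
  + r + (z - z′) * + c                   ∎)
  where
  lem₁ : ∀ r z c → r ≡ (r + z * c) - z * c
  lem₁ = solve-∀
  lem₂ : ∀ r z w c → (r + z * c) - w * c ≡ r + (z - w) * c
  lem₂ = solve-∀

rem-small : ∀ {c r} → r ℕ.< c → rem c (+ r) ≡ r
rem-small {suc c} {r} r<c = rem-unique 0ℤ r<c (sym (+-identityʳ (+ r)))

rem-periodic : ∀ c x z → rem c (x + z * + c) ≡ rem c x
rem-periodic zero      x z = refl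
rem-periodic c@(suc _) x z with rem-eq c x
... | w , eq = rem-unique (w + z) (rem< c x) (begin
  x + z * + c                        ≡⟨ cong (_+ z * + c) eq ⟩
  + rem c x + w * + c + z * + c      ≡⟨ regroup (+ rem c x) w z (+ c) ⟩
  + rem c x + (w + z) * + c          ∎)
  where
  regroup : ∀ r w z c → r + w * c + z * c ≡ r + (w + z) * c
  regroup = solve-∀

Periodic : ℕ → (ℤ → ℤ) → Set
Periodic c F = ∀ x z → F (x + z * + c) ≡ F x

periodic-rem : ∀ {c F} .{{_ : NonZero c}} → Periodic c F → ∀ x → F (+ rem c x) ≡ F x
periodic-rem {c} {F} per x with rem-eq c x
... | z , eq = begin
  F (+ rem c x)              ≡⟨ sym (per (+ rem c x) z) ⟩
  F (+ rem c x + z * + c)    ≡⟨ cong F (sym eq) ⟩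
  F x                        ∎

-- Carrying Bézout coefficients makes closure under products, signs and translations a ring
-- identity, and supplies inverses modulo b directly.
_⊥_ : ℤ → ℤ → Set
a ⊥ b = ∃₂ λ u v → u * a + v * b ≡ 1ℤ

infix 4 _⊥_

⊥-sym : ∀ {a b} → a ⊥ b → b ⊥ a
⊥-sym {a} {b} (u , v , eq) = v , u , trans (+-comm (v * b) (u * a)) eq

⊥-negˡ : ∀ {a b} → a ⊥ b → - a ⊥ b
⊥-negˡ {a} {b} (u , v , eq) = - u , v , trans (lem u a (v * b)) eq
  where
  lem : ∀ u a w → - u * - a + w ≡ u * a + w
  lem = solve-∀

⊥-1ˡ : ∀ {a} → 1ℤ ⊥ a
⊥-1ˡ {a} = 1ℤ , 0ℤ , refl

⊥-*ˡ : ∀ {a b c} → a ⊥ c → b ⊥ c → a * b ⊥ c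
⊥-*ˡ {a} {b} {c} (u , v , eq) (u′ , v′ , eq′) =
  u * u′ , u * a * v′ + v * (u′ * b + v′ * c) , (begin
    u * u′ * (a * b) + (u * a * v′ + v * (u′ * b + v′ * c)) * c  ≡⟨ lem a b c u v u′ v′ ⟩
    (u * a + v * c) * (u′ * b + v′ * c)                          ≡⟨ cong₂ _*_ eq eq′ ⟩
    1ℤ                                                           ∎)
  where
  lem : ∀ a b c u v u′ v′ → u * u′ * (a * b) + (u * a * v′ + v * (u′ * b + v′ * c)) * c
                          ≡ (u * a + v * c) * (u′ * b + v′ * c)
  lem = solve-∀

⊥-+-*ˡ : ∀ {a b} z → a ⊥ b → a + z * b ⊥ b
⊥-+-*ˡ {a} {b} z (u , v , eq) = u , v - u * z , trans (lem a b u v z) eq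
  where
  lem : ∀ a b u v z → u * (a + z * b) + (v - u * z) * b ≡ u * a + v * b
  lem = solve-∀

⊥-factorʳ : ∀ {a b c} → a ⊥ b * c → a ⊥ b
⊥-factorʳ {a} {b} {c} (u , v , eq) = u , v * c , trans (lem a b c u v) eq
  where
  lem : ∀ a b c u v → u * a + v * c * b ≡ u * a + v * (b * c)
  lem = solve-∀

-- Euclid's lemma: the Bézout equation times x exhibits x as a multiple of b.
⊥-cancelˡ : ∀ {a b x y} → a ⊥ b → a * x ≡ b * y → ∃ λ w → x ≡ b * w
⊥-cancelˡ {a} {b} {x} {y} (u , v , eq) ax≡by = u * y + v * x , (begin
  x                            ≡⟨ sym (*-identityˡ x) ⟩
  1ℤ * x                       ≡⟨ cong (_* x) (sym eq) ⟩
  (u * a + v * b) * x          ≡⟨ lem₁ a b x u v ⟩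
  u * (a * x) + v * b * x      ≡⟨ cong (λ w → u * w + v * b * x) ax≡by ⟩
  u * (b * y) + v * b * x      ≡⟨ lem₂ b x y u v ⟩
  b * (u * y + v * x)          ∎)
  where
  lem₁ : ∀ a b x u v → (u * a + v * b) * x ≡ u * (a * x) + v * b * x
  lem₁ = solve-∀
  lem₂ : ∀ b x y u v → u * (b * y) + v * b * x ≡ b * (u * y + v * x)
  lem₂ = solve-∀

Coprime⇒⊥ : ∀ {m n} → Coprime m n → + m ⊥ + n
Coprime⇒⊥ {m} {n} c with coprime-Bézout c
... | Bézout.+- x y eq = + x , - + y , (begin
  + x * + m + - + y * + n                       ≡⟨ cong (_+ - + y * + n) (trans (sym (pos-* x m)) (cong +_ (sym eq))) ⟩
  + (1 ℕ.+ y ℕ.* n) + - + y * + n               ≡⟨ cong (λ w → 1ℤ + w + - + y * + n) (pos-* y n) ⟩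
  1ℤ + + y * + n + - + y * + n                  ≡⟨ lem (+ y) (+ n) ⟩
  1ℤ                                            ∎)
  where
  lem : ∀ y n → 1ℤ + y * n + - y * n ≡ 1ℤ
  lem = solve-∀
... | Bézout.-+ x y eq = - + x , + y , (begin
  - + x * + m + + y * + n                       ≡⟨ cong (λ w → - + x * + m + w) (trans (sym (pos-* y n)) (cong +_ (sym eq))) ⟩
  - + x * + m + + (1 ℕ.+ x ℕ.* m)               ≡⟨ cong (λ w → - + x * + m + (1ℤ + w)) (pos-* x m) ⟩
  - + x * + m + (1ℤ + + x * + m)                ≡⟨ lem (+ x) (+ m) ⟩
  1ℤ                                            ∎)
  where
  lem : ∀ x m → - x * m + (1ℤ + x * m) ≡ 1ℤ
  lem = solve-∀

Coprime-∣∣⇒⊥ : ∀ a {n} → Coprime ∣ a ∣ n → a ⊥ + n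
Coprime-∣∣⇒⊥ (+ m)    c = Coprime⇒⊥ c
Coprime-∣∣⇒⊥ -[1+ m ] c = ⊥-negˡ (Coprime⇒⊥ c)

-- Sums of periodic functions over complete residue systems

∑-multiples : ∀ {b} .{{_ : NonZero b}} {a F} → a ⊥ + b → Periodic b F →
  ∑ b (λ i → F (a * + i)) ≡ ∑ b (λ i → F (+ i))
∑-multiples {b} {a} {F} (u , v , ua+vb≡1) per = begin
  ∑ b (λ i → F (a * + i))                   ≡⟨ ∑-cong b (λ i → sym (periodic-rem per (a * + i))) ⟩
  ∑ b (λ i → F (+ rem b (a * + i)))         ≡⟨ ∑≡sum b (λ i → F (+ rem b (a * + i))) ⟩
  sum {b} (λ i → F (+ rem b (a * + toℕ i))) ≡⟨ sum-cong-≗ {b} (λ i → cong (λ w → F (+ w)) (sym (toℕ-mul a i))) ⟩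
  sum {b} (λ i → F (+ toℕ (π ⟨$⟩ʳ i)))      ≡⟨ sym (sum-permute {b} (λ i → F (+ toℕ i)) π) ⟩
  sum {b} (λ i → F (+ toℕ i))               ≡⟨ sym (∑≡sum b (λ i → F (+ i))) ⟩
  ∑ b (λ i → F (+ i))                       ∎
  where
  mul : ℤ → Fin b → Fin b
  mul c i = fromℕ< (rem< b (c * + toℕ i))

  toℕ-mul : ∀ c i → toℕ (mul c i) ≡ rem b (c * + toℕ i)
  toℕ-mul c i = toℕ-fromℕ< (rem< b (c * + toℕ i))

  mul-inverse : ∀ c d → (∃ λ w → c * d ≡ 1ℤ - w * + b) → ∀ i → mul c (mul d i) ≡ i
  mul-inverse c d (w , cd≡) i = toℕ-injective (begin
    toℕ (mul c (mul d i))             ≡⟨ toℕ-mul c (mul d i) ⟩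
    rem b (c * + toℕ (mul d i))       ≡⟨ cong (λ r → rem b (c * + r)) (toℕ-mul d i) ⟩
    rem b (c * + r)                   ≡⟨ rem-unique (- (w * j) - c * z) (toℕ<n i) step ⟩
    toℕ i                             ∎)
    where
    j = + toℕ i
    r = rem b (d * j)
    z = proj₁ (rem-eq b (d * j))
    lem₁ : ∀ c r z b → c * r ≡ c * (r + z * b) - c * z * b
    lem₁ = solve-∀
    lem₂ : ∀ c d j y → c * (d * j) - y ≡ c * d * j - y
    lem₂ = solve-∀
    lem₃ : ∀ w b j c z → (1ℤ - w * b) * j - c * z * b ≡ j + (- (w * j) - c * z) * b
    lem₃ = solve-∀
    step : c * + r ≡ j + (- (w * j) - c * z) * + b
    step = begin
      c * + r                                    ≡⟨ lem₁ c (+ r) z (+ b) ⟩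
      c * (+ r + z * + b) - c * z * + b          ≡⟨ cong (λ y → c * y - c * z * + b) (sym (proj₂ (rem-eq b (d * j)))) ⟩
      c * (d * j) - c * z * + b                  ≡⟨ lem₂ c d j (c * z * + b) ⟩
      c * d * j - c * z * + b                    ≡⟨ cong (λ y → y * j - c * z * + b) cd≡ ⟩
      (1ℤ - w * + b) * j - c * z * + b           ≡⟨ lem₃ w (+ b) j c z ⟩
      j + (- (w * j) - c * z) * + b              ∎

  ua≡ : u * a ≡ 1ℤ - v * + b
  ua≡ = trans (lem (u * a) (v * + b)) (cong (_- v * + b) ua+vb≡1)
    where
    lem : ∀ x y → x ≡ x + y - y
    lem = solve-∀

  -- The Bézout coefficient u inverts a modulo b, so multiplication by a permutes the residues.
  π : Permutation′ b
  π = permutation (mul a) (mul u) (mul-inverse a u (v , trans (*-comm a u) ua≡)) (mul-inverse u a (v , ua≡))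

-- Moving the window by one drops its first term and gains the term a places later, which is equal
-- by periodicity. Iteration in both directions gives every z.
∑-shift : ∀ {a F} → Periodic a F → ∀ z → ∑ a (λ h → F (+ h + z)) ≡ ∑ a (λ h → F (+ h))
∑-shift {a} {F} per z = trans (shift z) (∑-cong a λ h → cong F (+-identityʳ (+ h)))
  where
  K : ℤ → ℤ
  K y = ∑ a (λ h → F (+ h + y))

  K-suc : ∀ y → K (1ℤ + y) ≡ K y
  K-suc y = begin
    K (1ℤ + y)                              ≡⟨ ∑-cong a (λ h → cong F (lem₁ (+ h) y)) ⟩
    ∑ a (λ h → F (+ suc h + y))             ≡⟨ lem₂ (F (0ℤ + y)) _ ⟩
    F (0ℤ + y) + ∑ a (λ h → F (+ suc h + y)) - F (0ℤ + y)
                                            ≡⟨ cong (_- F (0ℤ + y)) (sym (∑-suc a (λ h → F (+ h + y)))) ⟩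
    K y + F (+ a + y) - F (0ℤ + y)          ≡⟨ cong (λ w → K y + w - F (0ℤ + y)) (trans (cong F (lem₃ (+ a) y)) (per (0ℤ + y) 1ℤ)) ⟩
    K y + F (0ℤ + y) - F (0ℤ + y)           ≡⟨ lem₄ (K y) (F (0ℤ + y)) ⟩
    K y                                     ∎
    where
    lem₁ : ∀ h y → h + (1ℤ + y) ≡ 1ℤ + h + y
    lem₁ = solve-∀
    lem₂ : ∀ x w → w ≡ x + w - x
    lem₂ = solve-∀
    lem₃ : ∀ a y → a + y ≡ 0ℤ + y + 1ℤ * a
    lem₃ = solve-∀
    lem₄ : ∀ x w → x + w - w ≡ x
    lem₄ = solve-∀

  shift : ∀ z → K z ≡ K 0ℤ
  shift (+ zero)       = refl
  shift (+ suc n)      = trans (K-suc (+ n)) (shift (+ n))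
  shift -[1+ zero ]    = sym (K-suc -[1+ 0 ])
  shift -[1+ suc n ]   = trans (sym (K-suc -[1+ suc n ])) (shift -[1+ n ])

-- Adding z b to y amounts to replacing h by h + z, and a sum over a full period in h does not
-- notice this.
block-periodic : ∀ a b {F} → Periodic (a ℕ.* b) F → Periodic b (λ y → ∑ a (λ h → F (+ b * + h + y)))
block-periodic a b {F} per y z = begin
  ∑ a (λ h → F (+ b * + h + (y + z * + b)))  ≡⟨ ∑-cong a (λ h → cong F (lem (+ b) (+ h) y z)) ⟩
  ∑ a (λ h → F (+ b * (+ h + z) + y))        ≡⟨ ∑-shift {F = λ n → F (+ b * n + y)} per′ z ⟩
  ∑ a (λ h → F (+ b * + h + y))              ∎
  where
  lem : ∀ b h y z → b * h + (y + z * b) ≡ b * (h + z) + y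
  lem = solve-∀
  lem′ : ∀ a b x y w → b * (x + w * a) + y ≡ b * x + y + w * (a * b)
  lem′ = solve-∀
  per′ : Periodic a (λ n → F (+ b * n + y))
  per′ x w = begin
    F (+ b * (x + w * + a) + y)              ≡⟨ cong F (lem′ (+ a) (+ b) x y w) ⟩
    F (+ b * x + y + w * (+ a * + b))        ≡⟨ cong (λ n → F (+ b * x + y + w * n)) (sym (pos-* a b)) ⟩
    F (+ b * x + y + w * + (a ℕ.* b))        ≡⟨ per (+ b * x + y) w ⟩
    F (+ b * x + y)                          ∎

-- (h , i) ↦ b h − a i is the bijection ℤ/a × ℤ/b → ℤ/ab of the Chinese remainder theorem.
∑-crt : ∀ {a b} .{{_ : NonZero b}} {F} → + a ⊥ + b → Periodic (a ℕ.* b) F →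
  ∑ a (λ h → ∑ b (λ i → F (+ b * + h - + a * + i))) ≡ ∑ (a ℕ.* b) (λ n → F (+ n))
∑-crt {a} {b} {F} a⊥b per = begin
  ∑ a (λ h → ∑ b (λ i → F (+ b * + h - + a * + i)))
    ≡⟨ ∑-cong a (λ h → ∑-cong b (λ i → cong (λ w → F (+ b * + h + w)) (neg-distribˡ-* (+ a) (+ i)))) ⟩
  ∑ a (λ h → ∑ b (λ i → F (+ b * + h + - + a * + i)))
    ≡⟨ ∑-comm a b (λ h i → F (+ b * + h + - + a * + i)) ⟩
  ∑ b (λ i → G (- + a * + i))
    -- `G` depends only on its argument modulo b, where -a is a unit.
    ≡⟨ ∑-multiples {F = G} (⊥-negˡ a⊥b) (block-periodic a b per) ⟩
  ∑ b (λ i → G (+ i))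
    ≡⟨ ∑-comm b a (λ i h → F (+ b * + h + + i)) ⟩
  ∑ a (λ h → ∑ b (λ i → F (+ b * + h + + i)))
    ≡⟨ ∑-cong a (λ h → ∑-cong b (λ i → cong (λ w → F (w + + i)) (trans (*-comm (+ b) (+ h)) (sym (pos-* h b))))) ⟩
  ∑ a (λ h → ∑ b (λ i → F (+ (h ℕ.* b ℕ.+ i))))
    ≡⟨ sym (∑-blocks a b (λ n → F (+ n))) ⟩
  ∑ (a ℕ.* b) (λ n → F (+ n))  ∎
  where
  G : ℤ → ℤ
  G y = ∑ a (λ h → F (+ b * + h + y))

-- The sawtooth function

-- σ c x = 2c((x/c)), and δ c is the indicator of c ℤ; ζ c and η are the same as functions of the residue.

ζ : ℕ → ℕ → ℤ
ζ c zero      = 0ℤ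
ζ c r@(suc _) = + 2 * + r - + c

η : ℕ → ℤ
η zero    = 1ℤ
η (suc _) = 0ℤ

σ δ : ℕ → ℤ → ℤ
σ c x = ζ c (rem c x)
δ c x = η (rem c x)

σ-periodic : ∀ c → Periodic c (σ c)
σ-periodic c x z = cong (ζ c) (rem-periodic c x z)

δ-periodic : ∀ c → Periodic c (δ c)
δ-periodic c x z = cong η (rem-periodic c x z)

pos-∸ : ∀ {m n} → n ℕ.≤ m → + m - + n ≡ + (m ℕ.∸ n)
pos-∸ {m} {n} n≤m = trans (m-n≡m⊖n m n) (⊖-≥ n≤m)

rem-neg : ∀ c .{{_ : NonZero c}} x → rem c x ≢ 0 → rem c (- x) ≡ c ℕ.∸ rem c x
rem-neg c@(suc c′) x r≢0 with rem c x | rem< c x | rem-eq c x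
... | zero  | _   | _      = contradiction refl r≢0
... | suc r | r<c | z , eq = rem-unique (- z - 1ℤ) (s≤s (ℕ.m∸n≤m c′ r)) (begin
  - x                                             ≡⟨ cong -_ eq ⟩
  - (+ suc r + z * + c)                           ≡⟨ lem (+ suc r) z (+ c) ⟩
  (+ c - + suc r) + (- z - 1ℤ) * + c              ≡⟨ cong (_+ (- z - 1ℤ) * + c) (pos-∸ r≤c) ⟩
  + (c ℕ.∸ suc r) + (- z - 1ℤ) * + c              ∎)
  where
  r≤c : suc r ℕ.≤ c
  r≤c = ℕ.<⇒≤ r<c
  lem : ∀ r z c → - (r + z * c) ≡ (c - r) + (- z - 1ℤ) * c
  lem = solve-∀

rem-neg-zero : ∀ c x → rem c x ≡ 0 → rem c (- x) ≡ 0
rem-neg-zero zero      x _   = refl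
rem-neg-zero c@(suc _) x r≡0 with rem-eq c x
... | z , eq = rem-unique (- z) (s≤s z≤n) (begin
  - x                          ≡⟨ cong -_ eq ⟩
  - (+ rem c x + z * + c)      ≡⟨ cong (λ r → - (+ r + z * + c)) r≡0 ⟩
  - (0ℤ + z * + c)             ≡⟨ lem z (+ c) ⟩
  0ℤ + - z * + c               ∎)
  where
  lem : ∀ z c → - (0ℤ + z * c) ≡ 0ℤ + - z * c
  lem = solve-∀

ζ-reflect : ∀ c r → 0 ℕ.< r → r ℕ.< c → ζ c (c ℕ.∸ r) ≡ - ζ c r
ζ-reflect c r@(suc _) _ r<c with c ℕ.∸ r in eq
... | zero  = contradiction (ℕ.m∸n≡0⇒m≤n eq) (ℕ.<⇒≱ r<c)
... | suc s = begin
  + 2 * + suc s - + c               ≡⟨ cong (λ w → + 2 * w - + c) (cong +_ (sym eq)) ⟩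
  + 2 * + (c ℕ.∸ r) - + c           ≡⟨ cong (λ w → + 2 * w - + c) (sym (pos-∸ (ℕ.<⇒≤ r<c))) ⟩
  + 2 * (+ c - + r) - + c           ≡⟨ lem (+ c) (+ r) ⟩
  - (+ 2 * + r - + c)               ∎
  where
  lem : ∀ c r → + 2 * (c - r) - c ≡ - (+ 2 * r - c)
  lem = solve-∀

σ-neg : ∀ c x → σ c (- x) ≡ - σ c x
σ-neg zero x = refl
σ-neg c@(suc _) x with rem c x ℕ.≟ 0
... | yes r≡0 = trans (cong (ζ c) (rem-neg-zero c x r≡0)) (cong (λ r → - ζ c r) (sym r≡0))
... | no  r≢0 = trans (cong (ζ c) (rem-neg c x r≢0)) (ζ-reflect c (rem c x) (ℕ.n≢0⇒n>0 r≢0) (rem< c x))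

δ-neg : ∀ c x → δ c (- x) ≡ δ c x
δ-neg zero x = refl
δ-neg c@(suc _) x with rem c x ℕ.≟ 0
... | yes r≡0 = trans (cong η (rem-neg-zero c x r≡0)) (cong η (sym r≡0))
... | no  r≢0 = trans (cong η (rem-neg c x r≢0)) (trans (η≢0 (ℕ.m>n⇒m∸n≢0 (rem< c x))) (sym (η≢0 r≢0)))
  where
  η≢0 : ∀ {r} → r ≢ 0 → η r ≡ 0ℤ
  η≢0 {zero}  r≢0 = contradiction refl r≢0
  η≢0 {suc _} _   = refl

rem-scale : ∀ k .{{_ : NonZero k}} c .{{_ : NonZero c}} x → rem (k ℕ.* c) (+ k * x) ≡ k ℕ.* rem c x
rem-scale k@(suc _) c@(suc _) x with rem-eq c x
... | z , eq = rem-unique z (ℕ.*-monoʳ-< k (rem< c x)) (begin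
  + k * x                                      ≡⟨ cong (λ w → + k * w) eq ⟩
  + k * (+ rem c x + z * + c)                  ≡⟨ lem (+ k) (+ rem c x) z (+ c) ⟩
  + k * + rem c x + z * (+ k * + c)            ≡⟨ cong₂ (λ u v → u + z * v) (sym (pos-* k (rem c x))) (sym (pos-* k c)) ⟩
  + (k ℕ.* rem c x) + z * + (k ℕ.* c)          ∎)
  where
  lem : ∀ k r z c → k * (r + z * c) ≡ k * r + z * (k * c)
  lem = solve-∀

-- The point x/c is the same while the normalisation changes from 2c to 2kc. This brings sawtooth
-- values to a common denominator.
σ-scale : ∀ k .{{_ : NonZero k}} c .{{_ : NonZero c}} x → σ (k ℕ.* c) (+ k * x) ≡ + k * σ c x
σ-scale k@(suc _) c x = trans (cong (ζ (k ℕ.* c)) (rem-scale k c x)) (ζ-scale (rem c x))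
  where
  lem : ∀ k c r → + 2 * (k * r) - k * c ≡ k * (+ 2 * r - c)
  lem = solve-∀
  ζ-scale : ∀ r → ζ (k ℕ.* c) (k ℕ.* r) ≡ + k * ζ c r
  ζ-scale zero      = trans (cong (ζ (k ℕ.* c)) (ℕ.*-zeroʳ k)) (sym (*-zeroʳ (+ k)))
  ζ-scale r@(suc _) = begin
    + 2 * + (k ℕ.* r) - + (k ℕ.* c)  ≡⟨ cong₂ (λ u v → + 2 * u - v) (pos-* k r) (pos-* k c) ⟩
    + 2 * (+ k * + r) - + k * + c    ≡⟨ lem (+ k) (+ c) (+ r) ⟩
    + k * (+ 2 * + r - + c)          ∎

δ-scale : ∀ k .{{_ : NonZero k}} c .{{_ : NonZero c}} x → δ (k ℕ.* c) (+ k * x) ≡ δ c x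
δ-scale k@(suc _) c x = trans (cong η (rem-scale k c x)) (η-scale (rem c x))
  where
  η-scale : ∀ r → η (k ℕ.* r) ≡ η r
  η-scale zero    = cong η (ℕ.*-zeroʳ k)
  η-scale (suc _) = refl

-- The alternatives are no carry and one carry; the second is written additively to avoid a
-- truncated subtraction.
rem-+ : ∀ c .{{_ : NonZero c}} u v →
  rem c (u + v) ≡ rem c u ℕ.+ rem c v ⊎ c ℕ.+ rem c (u + v) ≡ rem c u ℕ.+ rem c v
rem-+ c u v with rem-eq c u | rem-eq c v | rem c u ℕ.+ rem c v ℕ.<? c
... | z , equ | w , eqv | yes r+s<c = inj₁ (rem-unique (z + w) r+s<c
  (trans (cong₂ _+_ equ eqv) (lem (+ rem c u) (+ rem c v) z w (+ c))))
  where
  lem : ∀ r s z w c → (r + z * c) + (s + w * c) ≡ r + s + (z + w) * c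
  lem = solve-∀
... | z , equ | w , eqv | no r+s≮c = inj₂ (trans (cong (c ℕ.+_) rem≡) c+t≡)
  where
  t = rem c u ℕ.+ rem c v ℕ.∸ c
  c≤r+s = ℕ.≮⇒≥ r+s≮c
  c+t≡ : c ℕ.+ t ≡ rem c u ℕ.+ rem c v
  c+t≡ = ℕ.m+[n∸m]≡n c≤r+s
  t<c : t ℕ.< c
  t<c = ℕ.+-cancelˡ-< c _ _ (subst (ℕ._< c ℕ.+ c) (sym c+t≡) (ℕ.+-mono-< (rem< c u) (rem< c v)))
  lem₁ : ∀ r s z w c → (r + z * c) + (s + w * c) ≡ r + s + (z + w) * c
  lem₁ = solve-∀
  lem₂ : ∀ t z w c → c + t + (z + w) * c ≡ t + (z + w + 1ℤ) * c
  lem₂ = solve-∀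
  rem≡ : rem c (u + v) ≡ t
  rem≡ = rem-unique (z + w + 1ℤ) t<c (begin
    u + v                                          ≡⟨ cong₂ _+_ equ eqv ⟩
    (+ rem c u + z * + c) + (+ rem c v + w * + c)  ≡⟨ lem₁ (+ rem c u) (+ rem c v) z w (+ c) ⟩
    + rem c u + + rem c v + (z + w) * + c          ≡⟨ cong (λ n → + n + (z + w) * + c) (sym c+t≡) ⟩
    + c + + t + (z + w) * + c                      ≡⟨ lem₂ (+ t) z w (+ c) ⟩
    + t + (z + w + 1ℤ) * + c                       ∎)

-- If none of u, v, u + v is divisible by c, the linear parts of σ leave -c without a carry and c
-- with one. Otherwise the defect is 0. The bracket is the matching indicator: two divisibilities
-- force the third, so it is 1 - 1 = 0 or 1 - 3 + 2 = 0.
σ-triangle : ∀ c .{{_ : NonZero c}} u v →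
  (σ c u + σ c v - σ c (u + v)) * (σ c u + σ c v - σ c (u + v))
    ≡ + c * + c * (1ℤ - δ c u - δ c v - δ c (u + v) + + 2 * (δ c u * δ c v))
σ-triangle c u v with rem-+ c u v
... | inj₁ eq = trans (cong (Lhs (rem c u) (rem c v)) eq)
  (trans (low (rem c u) (rem c v)) (cong (Rhs (rem c u) (rem c v)) (sym eq)))
  where
  Lhs Rhs : ℕ → ℕ → ℕ → ℤ
  Lhs r s t = (ζ c r + ζ c s - ζ c t) * (ζ c r + ζ c s - ζ c t)
  Rhs r s t = + c * + c * (1ℤ - η r - η s - η t + + 2 * (η r * η s))
  lem₀ : ∀ c x → (0ℤ + x - x) * (0ℤ + x - x) ≡ c * 0ℤ
  lem₀ = solve-∀
  lem₁ : ∀ c x → (x + 0ℤ - x) * (x + 0ℤ - x) ≡ c * 0ℤ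
  lem₁ = solve-∀
  lem₂ : ∀ c r s → (+ 2 * r - c + (+ 2 * s - c) - (+ 2 * (r + s) - c)) * (+ 2 * r - c + (+ 2 * s - c) - (+ 2 * (r + s) - c)) ≡ c * c * 1ℤ
  lem₂ = solve-∀
  low : ∀ r s → Lhs r s (r ℕ.+ s) ≡ Rhs r s (r ℕ.+ s)
  low zero    zero    = lem₀ (+ c * + c) 0ℤ
  low zero    (suc s) = lem₀ (+ c * + c) (ζ c (suc s))
  low (suc r) zero    = subst (λ t → Lhs (suc r) 0 t ≡ Rhs (suc r) 0 t)
    (sym (ℕ.+-identityʳ (suc r))) (lem₁ (+ c * + c) (ζ c (suc r)))
  low (suc r) (suc s) = lem₂ (+ c) (+ suc r) (+ suc s)
... | inj₂ eq = high (rem c u) (rem c v) (rem c (u + v)) (rem< c u) (rem< c v) eq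
  where
  lem₁ : ∀ r s → (+ 2 * r - (r + s) + (+ 2 * s - (r + s)) - 0ℤ) * (+ 2 * r - (r + s) + (+ 2 * s - (r + s)) - 0ℤ) ≡ (r + s) * (r + s) * 0ℤ
  lem₁ = solve-∀
  lem₂ : ∀ c r s t → (+ 2 * r - c + (+ 2 * s - c) - (+ 2 * t - c)) * (+ 2 * r - c + (+ 2 * s - c) - (+ 2 * t - c))
        ≡ (+ 2 * (r + s) - c - + 2 * t) * (+ 2 * (r + s) - c - + 2 * t)
  lem₂ = solve-∀
  lem₃ : ∀ c t → (+ 2 * (c + t) - c - + 2 * t) * (+ 2 * (c + t) - c - + 2 * t) ≡ c * c * 1ℤ
  lem₃ = solve-∀
  high : ∀ r s t → r ℕ.< c → s ℕ.< c → c ℕ.+ t ≡ r ℕ.+ s →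
    (ζ c r + ζ c s - ζ c t) * (ζ c r + ζ c s - ζ c t)
      ≡ + c * + c * (1ℤ - η r - η s - η t + + 2 * (η r * η s))
  -- A carry is impossible when one residue is 0, since the other would have to reach c.
  high zero    s    t r<c s<c eq = contradiction s<c (ℕ.≤⇒≯ (subst (c ℕ.≤_) eq (ℕ.m≤m+n c t)))
  high (suc r) zero t r<c s<c eq =
    contradiction r<c (ℕ.≤⇒≯ (subst (c ℕ.≤_) (trans eq (ℕ.+-identityʳ (suc r))) (ℕ.m≤m+n c t)))
  high (suc r) (suc s) zero r<c s<c eq = begin
    sq (+ c)
      ≡⟨ cong sq c≡ ⟩
    sq (+ suc r + + suc s)
      ≡⟨ lem₁ (+ suc r) (+ suc s) ⟩
    (+ suc r + + suc s) * (+ suc r + + suc s) * 0ℤ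
      ≡⟨ cong (λ c → c * c * 0ℤ) (sym c≡) ⟩
    + c * + c * 0ℤ ∎
    where
    sq : ℤ → ℤ
    sq c = (+ 2 * + suc r - c + (+ 2 * + suc s - c) - 0ℤ) * (+ 2 * + suc r - c + (+ 2 * + suc s - c) - 0ℤ)
    c≡ : + c ≡ + suc r + + suc s
    c≡ = cong +_ (trans (sym (ℕ.+-identityʳ c)) eq)
  high (suc r) (suc s) (suc t) r<c s<c eq = begin
    _
      ≡⟨ lem₂ (+ c) (+ suc r) (+ suc s) (+ suc t) ⟩
    (+ 2 * (+ suc r + + suc s) - + c - + 2 * + suc t) * (+ 2 * (+ suc r + + suc s) - + c - + 2 * + suc t)
      ≡⟨ cong (λ n → (+ 2 * + n - + c - + 2 * + suc t) * (+ 2 * + n - + c - + 2 * + suc t)) (sym eq) ⟩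
    (+ 2 * (+ c + + suc t) - + c - + 2 * + suc t) * (+ 2 * (+ c + + suc t) - + c - + 2 * + suc t)
      ≡⟨ lem₃ (+ c) (+ suc t) ⟩
    + c * + c * 1ℤ ∎

-- Distribution relations and second moment of the sawtooth

private
  gauss : ∀ a b y → + 2 * ∑ a (λ h → b * + h + y) ≡ + a * (+ a - 1ℤ) * b + + 2 * + a * y
  gauss zero    b y = lem b y
    where
    lem : ∀ b y → + 2 * 0ℤ ≡ 0ℤ * (0ℤ - 1ℤ) * b + + 2 * 0ℤ * y
    lem = solve-∀
  gauss (suc a) b y = begin
    + 2 * (∑ a (λ h → b * + h + y) + (b * + a + y))          ≡⟨ *-distribˡ-+ (+ 2) (∑ a (λ h → b * + h + y)) (b * + a + y) ⟩
    + 2 * ∑ a (λ h → b * + h + y) + + 2 * (b * + a + y)      ≡⟨ cong (_+ + 2 * (b * + a + y)) (gauss a b y) ⟩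
    + a * (+ a - 1ℤ) * b + + 2 * + a * y + + 2 * (b * + a + y)  ≡⟨ lem (+ a) b y ⟩
    (1ℤ + + a) * (1ℤ + + a - 1ℤ) * b + + 2 * (1ℤ + + a) * y  ∎
    where
    lem : ∀ a b y → a * (a - 1ℤ) * b + + 2 * a * y + + 2 * (b * a + y) ≡ (1ℤ + a) * (1ℤ + a - 1ℤ) * b + + 2 * (1ℤ + a) * y
    lem = solve-∀

-- The linear formula gives -c at residue 0, and the indicator corrects it to 0. Linear part and
-- indicator can then be summed separately.
ζ-η : ∀ c r → ζ c r ≡ + 2 * + r - + c + + c * η r
ζ-η c zero    = lem (+ c)
  where
  lem : ∀ c → 0ℤ ≡ + 2 * 0ℤ - c + c * 1ℤ
  lem = solve-∀
ζ-η c (suc r) = lem (+ 2 * + suc r - + c) (+ c)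
  where
  lem : ∀ x c → x ≡ x + c * 0ℤ
  lem = solve-∀

-- With h < a and a remainder below b, these are the base b digits of a number below ab, which is
-- its own residue.
rem-block : ∀ a b .{{_ : NonZero b}} h y → h ℕ.< a → rem (a ℕ.* b) (+ b * + h + + rem b y) ≡ b ℕ.* h ℕ.+ rem b y
rem-block a b h y h<a = trans (cong (λ w → rem (a ℕ.* b) (w + + rem b y)) (sym (pos-* b h))) (rem-small bound)
  where
  bound : b ℕ.* h ℕ.+ rem b y ℕ.< a ℕ.* b
  bound = ℕ.≤-trans (ℕ.+-monoʳ-< (b ℕ.* h) (rem< b y))
    (ℕ.≤-trans (ℕ.≤-reflexive (trans (ℕ.+-comm (b ℕ.* h) b) (cong (b ℕ.+_) (ℕ.*-comm b h)))) (ℕ.*-monoˡ-≤ b h<a))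

-- Once y is reduced to its residue r modulo b, the arguments b h + r are true residues modulo ab,
-- and only h = 0 with r = 0 yields 0.
δ-distribution : ∀ a .{{_ : NonZero a}} b .{{_ : NonZero b}} y →
  ∑ a (λ h → δ (a ℕ.* b) (+ b * + h + y)) ≡ δ b y
δ-distribution a@(suc a′) b@(suc _) y = begin
  ∑ a (λ h → δ (a ℕ.* b) (+ b * + h + y))
    ≡⟨ sym (periodic-rem {b} (block-periodic a b (δ-periodic (a ℕ.* b))) y) ⟩
  ∑ a (λ h → δ (a ℕ.* b) (+ b * + h + + r))
    ≡⟨ ∑-cong< a (λ h h<a → cong η (rem-block a b h y h<a)) ⟩
  ∑ a (λ h → η (b ℕ.* h ℕ.+ r))
    ≡⟨ ∑-suc a′ (λ h → η (b ℕ.* h ℕ.+ r)) ⟩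
  η (b ℕ.* 0 ℕ.+ r) + ∑ a′ (λ h → η (b ℕ.* suc h ℕ.+ r))
    ≡⟨ cong₂ _+_ (cong (λ w → η (w ℕ.+ r)) (ℕ.*-zeroʳ b)) (∑-zero a′ (λ _ _ → refl)) ⟩
  η r + 0ℤ
    ≡⟨ +-identityʳ (η r) ⟩
  η r ∎
  where r = rem b y

-- This is the relation that ((y/(ab) + h/a)), summed over h, gives ((y/b)); the factor a comes from
-- the normalisations 2ab and 2b. After reducing y, the linear part is an arithmetic progression and
-- the rest is `δ-distribution`.
σ-distribution : ∀ a .{{_ : NonZero a}} b .{{_ : NonZero b}} y →
  ∑ a (λ h → σ (a ℕ.* b) (+ b * + h + y)) ≡ + a * σ b y
σ-distribution a@(suc _) b@(suc _) y = begin
  ∑ a (λ h → σ ab (+ b * + h + y))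
    ≡⟨ sym (periodic-rem {b} (block-periodic a b (σ-periodic ab)) y) ⟩
  ∑ a (λ h → σ ab (+ b * + h + + r))
    ≡⟨ ∑-cong< a (λ h h<a → begin
         σ ab (+ b * + h + + r)  ≡⟨ ζ-η ab (rem ab (+ b * + h + + r)) ⟩
         + 2 * + rem ab (+ b * + h + + r) - + ab + + ab * δ ab (+ b * + h + + r)
           ≡⟨ cong (λ w → + 2 * w - + ab + + ab * δ ab (+ b * + h + + r))
                (trans (cong +_ (rem-block a b h y h<a)) (cong (_+ + r) (pos-* b h))) ⟩
         + 2 * (+ b * + h + + r) - + ab + + ab * δ ab (+ b * + h + + r) ∎) ⟩
  ∑ a (λ h → + 2 * (+ b * + h + + r) - + ab + + ab * δ ab (+ b * + h + + r))
    ≡⟨ ∑-+ a (λ h → + 2 * (+ b * + h + + r) - + ab) (λ h → + ab * δ ab (+ b * + h + + r)) ⟩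
  ∑ a (λ h → + 2 * (+ b * + h + + r) - + ab) + ∑ a (λ h → + ab * δ ab (+ b * + h + + r))
    ≡⟨ cong₂ _+_ (∑-+ a (λ h → + 2 * (+ b * + h + + r)) (λ _ → - + ab)) (∑-*ˡ a (+ ab) (λ h → δ ab (+ b * + h + + r))) ⟩
  ∑ a (λ h → + 2 * (+ b * + h + + r)) + ∑ a (λ _ → - + ab) + + ab * ∑ a (λ h → δ ab (+ b * + h + + r))
    ≡⟨ cong₂ _+_ (cong₂ _+_ (trans (∑-*ˡ a (+ 2) (λ h → + b * + h + + r)) (gauss a (+ b) (+ r))) (∑-const a (- + ab)))
                 (cong (λ w → + ab * w) (trans (δ-distribution a b (+ r)) (cong η (rem-small (rem< b y))))) ⟩
  + a * (+ a - 1ℤ) * + b + + 2 * + a * + r + + a * - + ab + + ab * η r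
    ≡⟨ cong (λ w → + a * (+ a - 1ℤ) * + b + + 2 * + a * + r + + a * - w + w * η r) (pos-* a b) ⟩
  + a * (+ a - 1ℤ) * + b + + 2 * + a * + r + + a * - (+ a * + b) + + a * + b * η r
    ≡⟨ lem (+ a) (+ b) (+ r) (η r) ⟩
  + a * (+ 2 * + r - + b + + b * η r)
    ≡⟨ cong (λ w → + a * w) (sym (ζ-η b r)) ⟩
  + a * ζ b r ∎
  where
  ab = a ℕ.* b
  r = rem b y
  lem : ∀ a b r e → a * (a - 1ℤ) * b + + 2 * a * r + a * - (a * b) + a * b * e ≡ a * (+ 2 * r - b + b * e)
  lem = solve-∀

∑δ : ∀ c .{{_ : NonZero c}} → ∑ c (λ n → δ c (+ n)) ≡ 1ℤ
∑δ c@(suc c′) = begin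
  ∑ c (λ n → δ c (+ n))        ≡⟨ ∑-cong< c (λ n n<c → cong η (rem-small n<c)) ⟩
  ∑ c η                        ≡⟨ ∑-suc c′ η ⟩
  1ℤ + ∑ c′ (λ _ → 0ℤ)         ≡⟨ cong (λ w → 1ℤ + w) (∑-zero c′ (λ _ _ → refl)) ⟩
  1ℤ                           ∎

-- The residue 0 contributes nothing and the others contribute (2n - c)². The factor 3 clears the
-- denominator left by the sum of squares.
∑σ² : ∀ c .{{_ : NonZero c}} → + 3 * ∑ c (λ n → σ c (+ n) * σ c (+ n)) ≡ + c * (+ c - 1ℤ) * (+ c - + 2)
∑σ² c@(suc c′) = begin
  + 3 * ∑ c (λ n → σ c (+ n) * σ c (+ n))
    ≡⟨ cong (λ w → + 3 * w) (∑-cong< c (λ n n<c → cong (λ r → ζ c r * ζ c r) (rem-small n<c))) ⟩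
  + 3 * ∑ c (λ n → ζ c n * ζ c n)
    ≡⟨ cong (λ w → + 3 * w) (trans (∑-suc c′ (λ n → ζ c n * ζ c n)) (+-identityˡ _)) ⟩
  + 3 * ∑ c′ (λ n → ζ c (suc n) * ζ c (suc n))
    ≡⟨ squares c′ (+ c) ⟩
  + 2 * + c′ * (+ c′ + 1ℤ) * (+ 2 * + c′ + 1ℤ) - + 6 * + c′ * (+ c′ + 1ℤ) * + c + + 3 * + c′ * + c * + c
    ≡⟨ lem (+ c′) ⟩
  + c * (+ c - 1ℤ) * (+ c - + 2) ∎
  where
  lem : ∀ d → + 2 * d * (d + 1ℤ) * (+ 2 * d + 1ℤ) - + 6 * d * (d + 1ℤ) * (1ℤ + d) + + 3 * d * (1ℤ + d) * (1ℤ + d)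
            ≡ (1ℤ + d) * (1ℤ + d - 1ℤ) * (1ℤ + d - + 2)
  lem = solve-∀
  -- The number of terms is decoupled from c so that the induction can keep c fixed; c = d + 1 is
  -- inserted only in `lem`.
  squares : ∀ d c → + 3 * ∑ d (λ n → (+ 2 * + suc n - c) * (+ 2 * + suc n - c))
    ≡ + 2 * + d * (+ d + 1ℤ) * (+ 2 * + d + 1ℤ) - + 6 * + d * (+ d + 1ℤ) * c + + 3 * + d * c * c
  squares zero c = lem₀ c
    where
    lem₀ : ∀ c → + 3 * 0ℤ ≡ + 2 * 0ℤ * (0ℤ + 1ℤ) * (+ 2 * 0ℤ + 1ℤ) - + 6 * 0ℤ * (0ℤ + 1ℤ) * c + + 3 * 0ℤ * c * c
    lem₀ = solve-∀
  squares (suc d) c = begin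
    + 3 * (Σd + (+ 2 * + suc d - c) * (+ 2 * + suc d - c))       ≡⟨ *-distribˡ-+ (+ 3) Σd _ ⟩
    + 3 * Σd + + 3 * ((+ 2 * + suc d - c) * (+ 2 * + suc d - c)) ≡⟨ cong (_+ + 3 * ((+ 2 * + suc d - c) * (+ 2 * + suc d - c))) (squares d c) ⟩
    _                                                           ≡⟨ lem₁ (+ d) c ⟩
    _                                                           ∎
    where
    Σd = ∑ d (λ n → (+ 2 * + suc n - c) * (+ 2 * + suc n - c))
    lem₁ : ∀ d c →
      + 2 * d * (d + 1ℤ) * (+ 2 * d + 1ℤ) - + 6 * d * (d + 1ℤ) * c + + 3 * d * c * c
        + + 3 * ((+ 2 * (1ℤ + d) - c) * (+ 2 * (1ℤ + d) - c))
      ≡ + 2 * (1ℤ + d) * (1ℤ + d + 1ℤ) * (+ 2 * (1ℤ + d) + 1ℤ) - + 6 * (1ℤ + d) * (1ℤ + d + 1ℤ) * c + + 3 * (1ℤ + d) * c * c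
    lem₁ = solve-∀

-- The three-term relation

∑³ : ℕ → ℕ → ℕ → (ℕ → ℕ → ℕ → ℤ) → ℤ
∑³ a b c F = ∑ a λ h → ∑ b λ i → ∑ c λ j → F h i j

∑³-cong : ∀ a b c {F G} → (∀ h i j → F h i j ≡ G h i j) → ∑³ a b c F ≡ ∑³ a b c G
∑³-cong a b c eq = ∑-cong a λ h → ∑-cong b λ i → ∑-cong c λ j → eq h i j

-- A formal linear combination is kept as a list of coefficients and functions, so that linearity of
-- the triple sum is proved once for all the expansions below.
Term : Set
Term = ℤ × (ℕ → ℕ → ℕ → ℤ)

combination : List Term → ℕ → ℕ → ℕ → ℤ
combination ts h i j = foldr (λ (k , F) s → k * F h i j + s) 0ℤ ts

∑³-combination : ∀ a b c ts →
  ∑³ a b c (combination ts) ≡ foldr (λ (k , F) s → k * ∑³ a b c F + s) 0ℤ ts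
∑³-combination a b c [] = ∑-zero a λ _ _ → ∑-zero b λ _ _ → ∑-zero c λ _ _ → refl
∑³-combination a b c ((k , F) ∷ ts) = begin
  ∑³ a b c (λ h i j → k * F h i j + G h i j)
    ≡⟨ ∑-cong a (λ h → trans (∑-cong b λ i → linear c (F h i) (G h i)) (linear b (λ i → ∑ c (F h i)) (λ i → ∑ c (G h i)))) ⟩
  ∑ a (λ h → k * (∑ b λ i → ∑ c (F h i)) + (∑ b λ i → ∑ c (G h i)))
    ≡⟨ linear a (λ h → ∑ b λ i → ∑ c (F h i)) (λ h → ∑ b λ i → ∑ c (G h i)) ⟩
  k * ∑³ a b c F + ∑³ a b c G
    ≡⟨ cong (λ s → k * ∑³ a b c F + s) (∑³-combination a b c ts) ⟩
  k * ∑³ a b c F + foldr (λ (k , F) s → k * ∑³ a b c F + s) 0ℤ ts ∎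
  where
  G = combination ts
  linear : ∀ n f g → ∑ n (λ i → k * f i + g i) ≡ k * ∑ n f + ∑ n g
  linear n f g = trans (∑-+ n (λ i → k * f i) g) (cong (_+ ∑ n g) (∑-*ˡ n k f))

-- Cyclic symmetry lets one evaluation serve all three pairs of moduli.
∑³-rotate : ∀ a b c F → ∑³ a b c F ≡ ∑³ b c a (λ i j h → F h i j)
∑³-rotate a b c F = trans (∑-comm a b (λ h i → ∑ c (F h i))) (∑-cong b λ i → ∑-comm a c (λ h j → F h i j))

∑³-const : ∀ a b c (f : ℕ → ℕ → ℤ) → ∑³ a b c (λ h i _ → f h i) ≡ + c * (∑ a λ h → ∑ b λ i → f h i)
∑³-const a b c f = trans
  (∑-cong a λ h → trans (∑-cong b λ i → ∑-const c (f h i)) (∑-*ˡ b (+ c) (f h)))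
  (∑-*ˡ a (+ c) (λ h → ∑ b (f h)))

-- For fixed i the variables h and j separate. Each inner sum then collapses by a distribution
-- relation, leaving a single sum over i.
∑³-* : ∀ a b c (f g : ℕ → ℕ → ℤ) →
  ∑³ a b c (λ h i j → f h i * g i j) ≡ ∑ b λ i → (∑ a λ h → f h i) * (∑ c λ j → g i j)
∑³-* a b c f g = begin
  ∑³ a b c (λ h i j → f h i * g i j)            ≡⟨ ∑-cong a (λ h → ∑-cong b λ i → ∑-*ˡ c (f h i) (g i)) ⟩
  (∑ a λ h → ∑ b λ i → f h i * ∑ c (g i))       ≡⟨ ∑-comm a b (λ h i → f h i * ∑ c (g i)) ⟩
  (∑ b λ i → ∑ a λ h → f h i * ∑ c (g i))       ≡⟨ ∑-cong b (λ i → ∑-*ʳ a (∑ c (g i)) (λ h → f h i)) ⟩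
  (∑ b λ i → (∑ a λ h → f h i) * ∑ c (g i))     ∎

-- σ₂ a b h i = 2ab((h/a − i/b)).
σ₂ δ₂ : ℕ → ℕ → ℕ → ℕ → ℤ
σ₂ a b h i = σ (a ℕ.* b) (+ b * + h - + a * + i)
δ₂ a b h i = δ (a ℕ.* b) (+ b * + h - + a * + i)

private
  minus-swap : ∀ x y → x - y ≡ - (y + - x)
  minus-swap = solve-∀

∑σ₂-left : ∀ a .{{_ : NonZero a}} b .{{_ : NonZero b}} i → ∑ a (λ h → σ₂ a b h i) ≡ - (+ a * σ b (+ a * + i))
∑σ₂-left a b i = begin
  ∑ a (λ h → σ₂ a b h i)        ≡⟨ σ-distribution a b (- (+ a * + i)) ⟩
  + a * σ b (- (+ a * + i))     ≡⟨ cong (λ w → + a * w) (σ-neg b (+ a * + i)) ⟩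
  + a * - σ b (+ a * + i)       ≡⟨ sym (neg-distribʳ-* (+ a) (σ b (+ a * + i))) ⟩
  - (+ a * σ b (+ a * + i))     ∎

-- Since i/b - j/c is the negative of j/c - i/b, oddness reduces this to the left sum and accounts
-- for the opposite sign.
∑σ₂-right : ∀ b .{{_ : NonZero b}} c .{{_ : NonZero c}} i → ∑ c (λ j → σ₂ b c i j) ≡ + c * σ b (+ c * + i)
∑σ₂-right b c i = begin
  ∑ c (λ j → σ₂ b c i j)            ≡⟨ ∑-cong c flip ⟩
  ∑ c (λ j → - σ₂ c b j i)          ≡⟨ ∑-neg c (λ j → σ₂ c b j i) ⟩
  - ∑ c (λ j → σ₂ c b j i)          ≡⟨ cong -_ (∑σ₂-left c b i) ⟩
  - - (+ c * σ b (+ c * + i))       ≡⟨ neg-involutive (+ c * σ b (+ c * + i)) ⟩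
  + c * σ b (+ c * + i)             ∎
  where
  flip : ∀ j → σ₂ b c i j ≡ - σ₂ c b j i
  flip j = trans (cong₂ σ (ℕ.*-comm b c) (minus-swap (+ c * + i) (+ b * + j))) (σ-neg (c ℕ.* b) (+ b * + j - + c * + i))

∑δ₂-left : ∀ a .{{_ : NonZero a}} b .{{_ : NonZero b}} i → ∑ a (λ h → δ₂ a b h i) ≡ δ b (+ a * + i)
∑δ₂-left a b i = trans (δ-distribution a b (- (+ a * + i))) (δ-neg b (+ a * + i))

∑δ₂-right : ∀ b .{{_ : NonZero b}} c .{{_ : NonZero c}} i → ∑ c (λ j → δ₂ b c i j) ≡ δ b (+ c * + i)
∑δ₂-right b c i = trans (∑-cong c flip) (∑δ₂-left c b i)
  where
  flip : ∀ j → δ₂ b c i j ≡ δ₂ c b j i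
  flip j = trans (cong₂ δ (ℕ.*-comm b c) (minus-swap (+ c * + i) (+ b * + j))) (δ-neg (c ℕ.* b) (+ b * + j - + c * + i))

-- D x y c = 4c² s(x, y; c), so that S(a,b) = 3 D 1 a b / b².
D : ℤ → ℤ → ℕ → ℤ
D x y c = ∑ c λ j → σ c (x * + j) * σ c (y * + j)

-- The sign is negative because i/b is subtracted in the first factor and added in the second.
∑³-σ₂σ₂ : ∀ a .{{_ : NonZero a}} b .{{_ : NonZero b}} c .{{_ : NonZero c}} →
  ∑³ a b c (λ h i j → σ₂ a b h i * σ₂ b c i j) ≡ - (+ a * + c * D (+ a) (+ c) b)
∑³-σ₂σ₂ a b c = begin
  ∑³ a b c (λ h i j → σ₂ a b h i * σ₂ b c i j)
    ≡⟨ ∑³-* a b c (σ₂ a b) (σ₂ b c) ⟩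
  (∑ b λ i → (∑ a λ h → σ₂ a b h i) * (∑ c λ j → σ₂ b c i j))
    ≡⟨ ∑-cong b (λ i → cong₂ _*_ (∑σ₂-left a b i) (∑σ₂-right b c i)) ⟩
  (∑ b λ i → - (+ a * σ b (+ a * + i)) * (+ c * σ b (+ c * + i)))
    ≡⟨ ∑-cong b (λ i → lem (+ a) (+ c) (σ b (+ a * + i)) (σ b (+ c * + i))) ⟩
  (∑ b λ i → - (+ a * + c) * (σ b (+ a * + i) * σ b (+ c * + i)))
    ≡⟨ ∑-*ˡ b (- (+ a * + c)) (λ i → σ b (+ a * + i) * σ b (+ c * + i)) ⟩
  - (+ a * + c) * D (+ a) (+ c) b
    ≡⟨ sym (neg-distribˡ-* (+ a * + c) (D (+ a) (+ c) b)) ⟩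
  - (+ a * + c * D (+ a) (+ c) b) ∎
  where
  lem : ∀ a c x y → - (a * x) * (c * y) ≡ - (a * c) * (x * y)
  lem = solve-∀

-- The free variable j gives the factor c, and b h - a i runs once through the residues modulo ab,
-- which leaves a second moment.
∑³-σ₂² : ∀ a .{{_ : NonZero a}} b .{{_ : NonZero b}} c → + a ⊥ + b →
  + 3 * ∑³ a b c (λ h i _ → σ₂ a b h i * σ₂ a b h i)
    ≡ + c * ((+ a * + b) * (+ a * + b - 1ℤ) * (+ a * + b - + 2))
∑³-σ₂² a@(suc _) b@(suc _) c a⊥b = begin
  + 3 * ∑³ a b c (λ h i _ → σ₂ a b h i * σ₂ a b h i)
    ≡⟨ cong (λ w → + 3 * w) (∑³-const a b c (λ h i → σ₂ a b h i * σ₂ a b h i)) ⟩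
  + 3 * (+ c * (∑ a λ h → ∑ b λ i → σ₂ a b h i * σ₂ a b h i))
    ≡⟨ cong (λ w → + 3 * (+ c * w)) (∑-crt {F = λ n → σ ab n * σ ab n} a⊥b
         (λ x z → cong (λ w → w * w) (σ-periodic ab x z))) ⟩
  + 3 * (+ c * ∑ ab (λ n → σ ab (+ n) * σ ab (+ n)))
    ≡⟨ lem (+ c) (∑ ab (λ n → σ ab (+ n) * σ ab (+ n))) ⟩
  + c * (+ 3 * ∑ ab (λ n → σ ab (+ n) * σ ab (+ n)))
    ≡⟨ cong (λ w → + c * w) (∑σ² ab) ⟩
  + c * (+ ab * (+ ab - 1ℤ) * (+ ab - + 2))
    ≡⟨ cong (λ n → + c * (n * (n - 1ℤ) * (n - + 2))) (pos-* a b) ⟩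
  + c * ((+ a * + b) * (+ a * + b - 1ℤ) * (+ a * + b - + 2)) ∎
  where
  ab = a ℕ.* b
  lem : ∀ c s → + 3 * (c * s) ≡ c * (+ 3 * s)
  lem = solve-∀

∑³-δ₂ : ∀ a .{{_ : NonZero a}} b .{{_ : NonZero b}} c → + a ⊥ + b → ∑³ a b c (λ h i _ → δ₂ a b h i) ≡ + c
∑³-δ₂ a@(suc _) b@(suc _) c a⊥b = begin
  ∑³ a b c (λ h i _ → δ₂ a b h i)              ≡⟨ ∑³-const a b c (δ₂ a b) ⟩
  + c * (∑ a λ h → ∑ b λ i → δ₂ a b h i)       ≡⟨ cong (λ w → + c * w) (∑-crt {F = δ ab} a⊥b (δ-periodic ab)) ⟩
  + c * ∑ ab (λ n → δ ab (+ n))                ≡⟨ cong (λ w → + c * w) (∑δ ab) ⟩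
  + c * 1ℤ                                     ≡⟨ *-identityʳ (+ c) ⟩
  + c                                          ∎
  where ab = a ℕ.* b

-- A multiple of b stays one after multiplication by a; the converse is Euclid's lemma.
δ-unit : ∀ {a b} .{{_ : NonZero b}} → a ⊥ + b → ∀ x → δ b (a * x) ≡ δ b x
δ-unit {a} {b@(suc _)} a⊥b x = by-cases (rem b x) refl (rem b (a * x)) refl
  where
  by-cases : ∀ r → rem b x ≡ r → ∀ s → rem b (a * x) ≡ s → η s ≡ η r
  by-cases zero    _ zero    _ = refl
  by-cases (suc _) _ (suc _) _ = refl
  by-cases zero remx≡0 (suc s) remax≡ with rem-eq b x
  ... | z , eq = contradiction (trans (sym remax≡) (rem-unique {b} {a * x} {0} (a * z) (s≤s z≤n) (begin
    a * x                           ≡⟨ cong (λ w → a * w) eq ⟩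
    a * (+ rem b x + z * + b)       ≡⟨ cong (λ r → a * (+ r + z * + b)) remx≡0 ⟩
    a * (0ℤ + z * + b)              ≡⟨ lem a z (+ b) ⟩
    0ℤ + a * z * + b                ∎))) λ()
    where
    lem : ∀ a z b → a * (0ℤ + z * b) ≡ 0ℤ + a * z * b
    lem = solve-∀
  by-cases (suc r) remx≡ zero remax≡0 with rem-eq b (a * x)
  ... | z , eq with ⊥-cancelˡ {x = x} {y = z} a⊥b (trans eq (trans (cong (λ r → + r + z * + b) remax≡0) (trans (+-identityˡ (z * + b)) (*-comm z (+ b)))))
  ... | w , x≡bw = contradiction (trans (sym remx≡) (rem-unique {b} {x} {0} w (s≤s z≤n)
        (trans x≡bw (trans (*-comm (+ b) w) (sym (+-identityˡ (w * + b))))))) λ()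

-- Summing out h and j leaves the conditions that b divides a i and c i; as a and c are units modulo
-- b, only i = 0 survives.
∑³-δ₂δ₂ : ∀ a .{{_ : NonZero a}} b .{{_ : NonZero b}} c .{{_ : NonZero c}} → + a ⊥ + b → + c ⊥ + b →
  ∑³ a b c (λ h i j → δ₂ a b h i * δ₂ b c i j) ≡ 1ℤ
∑³-δ₂δ₂ a b c a⊥b c⊥b = begin
  ∑³ a b c (λ h i j → δ₂ a b h i * δ₂ b c i j)
    ≡⟨ ∑³-* a b c (δ₂ a b) (δ₂ b c) ⟩
  (∑ b λ i → (∑ a λ h → δ₂ a b h i) * (∑ c λ j → δ₂ b c i j))
    ≡⟨ ∑-cong b (λ i → cong₂ _*_ (trans (∑δ₂-left a b i) (δ-unit a⊥b (+ i))) (trans (∑δ₂-right b c i) (δ-unit c⊥b (+ i)))) ⟩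
  (∑ b λ i → δ b (+ i) * δ b (+ i))
    ≡⟨ ∑-cong b (λ i → η-idem (rem b (+ i))) ⟩
  (∑ b λ i → δ b (+ i))
    ≡⟨ ∑δ b ⟩
  1ℤ ∎
  where
  η-idem : ∀ r → η r * η r ≡ η r
  η-idem zero    = refl
  η-idem (suc _) = refl

module _ (a b c : ℕ) .{{a≢0 : NonZero a}} .{{b≢0 : NonZero b}} .{{c≢0 : NonZero c}} where

  private
    A = + a
    B = + b
    C = + c
    N = A * B * C
    X Y Z X° Y° Z° : ℕ → ℕ → ℕ → ℤ
    X  h i j = σ₂ a b h i
    Y  h i j = σ₂ b c i j
    Z  h i j = σ₂ c a j h
    X° h i j = δ₂ a b h i
    Y° h i j = δ₂ b c i j
    Z° h i j = δ₂ c a j h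

  -- The three arguments h/a − i/b, i/b − j/c, j/c − h/a sum to zero.
  triangle : ∀ h i j →
    (C * X h i j + A * Y h i j + B * Z h i j) * (C * X h i j + A * Y h i j + B * Z h i j)
      ≡ N * N * (1ℤ - X° h i j - Y° h i j - Z° h i j + + 2 * (X° h i j * Y° h i j))
  triangle h i j = begin
    (C * X h i j + A * Y h i j + B * Z h i j) * (C * X h i j + A * Y h i j + B * Z h i j)
      -- The weights C, A, B bring the denominators ab, bc, ca to abc. There the third argument is
      -- -(u + v), so oddness turns the sum into the defect of `σ-triangle`.
      ≡⟨ cong (λ w → w * w) (cong₂ _+_ (cong₂ _+_ (sym (σ-at c (a ℕ.* b) x nX)) (sym (σ-at a (b ℕ.* c) y nY)))
           (trans (sym (σ-at b (c ℕ.* a) z nZ)) (trans (cong (σ n) u+v≡) (σ-neg n (u + v))))) ⟩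
    (σ n u + σ n v - σ n (u + v)) * (σ n u + σ n v - σ n (u + v))
      ≡⟨ σ-triangle n u v ⟩
    + n * + n * (1ℤ - δ n u - δ n v - δ n (u + v) + + 2 * (δ n u * δ n v))
      ≡⟨ cong₂ (λ p q → p * p * q) (trans (pos-* (a ℕ.* b) c) (cong (_* C) (pos-* a b)))
           (δ-cong (δ-at c (a ℕ.* b) x nX) (δ-at a (b ℕ.* c) y nY)
             (trans (sym (trans (cong (δ n) u+v≡) (δ-neg n (u + v)))) (δ-at b (c ℕ.* a) z nZ))) ⟩
    N * N * (1ℤ - X° h i j - Y° h i j - Z° h i j + + 2 * (X° h i j * Y° h i j)) ∎
    where
    n = a ℕ.* b ℕ.* c
    instance
      _ = ℕ.m*n≢0 a b
      _ = ℕ.m*n≢0 b c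
      _ = ℕ.m*n≢0 c a
      n≢0 : NonZero n
      n≢0 = ℕ.m*n≢0 (a ℕ.* b) c
    x = B * + h - A * + i
    y = C * + i - B * + j
    z = A * + j - C * + h
    u = C * x
    v = A * y
    lem : ∀ a b c h i j → b * (a * j - c * h) ≡ - (c * (b * h - a * i) + a * (c * i - b * j))
    lem = solve-∀
    u+v≡ : B * z ≡ - (u + v)
    u+v≡ = lem A B C (+ h) (+ i) (+ j)
    nX : n ≡ c ℕ.* (a ℕ.* b)
    nX = ℕ.*-comm (a ℕ.* b) c
    nY : n ≡ a ℕ.* (b ℕ.* c)
    nY = ℕ.*-assoc a b c
    nZ : n ≡ b ℕ.* (c ℕ.* a)
    nZ = trans nY (trans (ℕ.*-comm a (b ℕ.* c)) (ℕ.*-assoc b c a))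
    σ-at : ∀ k .{{_ : NonZero k}} m .{{_ : NonZero m}} x → n ≡ k ℕ.* m → σ n (+ k * x) ≡ + k * σ m x
    σ-at k m x eq = trans (cong (λ n → σ n (+ k * x)) eq) (σ-scale k m x)
    δ-at : ∀ k .{{_ : NonZero k}} m .{{_ : NonZero m}} x → n ≡ k ℕ.* m → δ n (+ k * x) ≡ δ m x
    δ-at k m x eq = trans (cong (λ n → δ n (+ k * x)) eq) (δ-scale k m x)
    δ-cong : ∀ {p q r p′ q′ r′} → p ≡ p′ → q ≡ q′ → r ≡ r′ →
      1ℤ - p - q - r + + 2 * (p * q) ≡ 1ℤ - p′ - q′ - r′ + + 2 * (p′ * q′)
    δ-cong refl refl refl = refl

  module _ (a⊥b : A ⊥ B) (b⊥c : B ⊥ C) (c⊥a : C ⊥ A) where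
    private
      rotate : ∀ F → ∑³ a b c F ≡ ∑³ b c a (λ i j h → F h i j)
      rotate = ∑³-rotate a b c
      rotate² : ∀ F → ∑³ a b c F ≡ ∑³ c a b (λ j h i → F h i j)
      rotate² F = trans (rotate F) (∑³-rotate b c a (λ i j h → F h i j))

      XX YY ZZ XY YZ ZX XY° : ℕ → ℕ → ℕ → ℤ
      XX h i j = X h i j * X h i j
      YY h i j = Y h i j * Y h i j
      ZZ h i j = Z h i j * Z h i j
      XY h i j = X h i j * Y h i j
      YZ h i j = Y h i j * Z h i j
      ZX h i j = Z h i j * X h i j
      XY° h i j = X° h i j * Y° h i j

      -- The first two lists expand the square in `triangle`, the mixed products taken once; the
      -- third is its indicator bracket.
      squares mixed counts : List Term
      squares = (C * C , XX) ∷ (A * A , YY) ∷ (B * B , ZZ) ∷ []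
      mixed = (A * C , XY) ∷ (B * A , YZ) ∷ (C * B , ZX) ∷ []
      counts = (1ℤ , λ _ _ _ → 1ℤ) ∷ (- 1ℤ , X°) ∷ (- 1ℤ , Y°) ∷ (- 1ℤ , Z°) ∷ (+ 2 , XY°) ∷ []

      balance : ∀ h i j → combination ((1ℤ , combination squares) ∷ (+ 2 , combination mixed) ∷ []) h i j
        ≡ combination ((N * N , combination counts) ∷ []) h i j
      balance h i j = trans (lem₁ A B C (X h i j) (Y h i j) (Z h i j))
        (trans (triangle h i j) (lem₂ (N * N) (X° h i j) (Y° h i j) (Z° h i j)))
        where
        lem₁ : ∀ a b c x y z →
          1ℤ * (c * c * (x * x) + (a * a * (y * y) + (b * b * (z * z) + 0ℤ)))
            + (+ 2 * (a * c * (x * y) + (b * a * (y * z) + (c * b * (z * x) + 0ℤ))) + 0ℤ)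
          ≡ (c * x + a * y + b * z) * (c * x + a * y + b * z)
        lem₁ = solve-∀
        lem₂ : ∀ n x y z → n * (1ℤ - x - y - z + + 2 * (x * y))
          ≡ n * (1ℤ * 1ℤ + (- 1ℤ * x + (- 1ℤ * y + (- 1ℤ * z + (+ 2 * (x * y) + 0ℤ))))) + 0ℤ
        lem₂ = solve-∀

      P : ℤ → ℤ → ℤ → ℤ
      P x y z = z * ((x * y) * (x * y - 1ℤ) * (x * y - + 2))

      ∑squares : + 3 * ∑³ a b c (combination squares) ≡ C * C * P A B C + (A * A * P B C A + B * B * P C A B)
      ∑squares = begin
        + 3 * ∑³ a b c (combination squares)
          ≡⟨ cong (λ w → + 3 * w) (∑³-combination a b c squares) ⟩
        + 3 * (C * C * ∑³ a b c XX + (A * A * ∑³ a b c YY + (B * B * ∑³ a b c ZZ + 0ℤ)))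
          ≡⟨ lem (A * A) (B * B) (C * C) (∑³ a b c XX) (∑³ a b c YY) (∑³ a b c ZZ) ⟩
        C * C * (+ 3 * ∑³ a b c XX) + (A * A * (+ 3 * ∑³ a b c YY) + B * B * (+ 3 * ∑³ a b c ZZ))
          ≡⟨ cong₂ (λ x y → C * C * x + y) (∑³-σ₂² a b c a⊥b) (cong₂ (λ y z → A * A * y + B * B * z)
               (trans (cong (λ w → + 3 * w) (rotate YY)) (∑³-σ₂² b c a b⊥c))
               (trans (cong (λ w → + 3 * w) (rotate² ZZ)) (∑³-σ₂² c a b c⊥a))) ⟩
        C * C * P A B C + (A * A * P B C A + B * B * P C A B) ∎
        where
        lem : ∀ a b c x y z → + 3 * (c * x + (a * y + (b * z + 0ℤ))) ≡ c * (+ 3 * x) + (a * (+ 3 * y) + b * (+ 3 * z))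
        lem = solve-∀

      ∑mixed : ∑³ a b c (combination mixed)
        ≡ - (A * C * (A * C * D A C b) + B * A * (B * A * D B A c) + C * B * (C * B * D C B a))
      ∑mixed = begin
        ∑³ a b c (combination mixed)
          ≡⟨ ∑³-combination a b c mixed ⟩
        A * C * ∑³ a b c XY + (B * A * ∑³ a b c YZ + (C * B * ∑³ a b c ZX + 0ℤ))
          ≡⟨ cong₂ (λ x y → A * C * x + y) (∑³-σ₂σ₂ a b c) (cong₂ (λ y z → B * A * y + (C * B * z + 0ℤ))
               (trans (rotate YZ) (∑³-σ₂σ₂ b c a)) (trans (rotate² ZX) (∑³-σ₂σ₂ c a b))) ⟩
        A * C * - (A * C * D A C b) + (B * A * - (B * A * D B A c) + (C * B * - (C * B * D C B a) + 0ℤ))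
          ≡⟨ lem (A * C) (B * A) (C * B) (D A C b) (D B A c) (D C B a) ⟩
        - (A * C * (A * C * D A C b) + B * A * (B * A * D B A c) + C * B * (C * B * D C B a)) ∎
        where
        lem : ∀ p q r x y z → p * - (p * x) + (q * - (q * y) + (r * - (r * z) + 0ℤ)) ≡ - (p * (p * x) + q * (q * y) + r * (r * z))
        lem = solve-∀

      -- A coincidence of two of the three fractions modulo 1 occurs for C, A or B triples, with one
      -- variable free in each case; all three coincide in one triple only.
      ∑counts : ∑³ a b c (combination counts) ≡ N - C - A - B + + 2
      ∑counts = begin
        ∑³ a b c (combination counts)
          ≡⟨ ∑³-combination a b c counts ⟩
        1ℤ * ∑³ a b c (λ _ _ _ → 1ℤ) + (- 1ℤ * ∑³ a b c X° + (- 1ℤ * ∑³ a b c Y° + (- 1ℤ * ∑³ a b c Z° + (+ 2 * ∑³ a b c XY° + 0ℤ))))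
          ≡⟨ cong₂ (λ s t → 1ℤ * s + t) ∑ones (cong₂ (λ x t → - 1ℤ * x + t) (∑³-δ₂ a b c a⊥b)
               (cong₂ (λ y t → - 1ℤ * y + t) (trans (rotate Y°) (∑³-δ₂ b c a b⊥c))
               (cong₂ (λ z t → - 1ℤ * z + (+ 2 * t + 0ℤ)) (trans (rotate² Z°) (∑³-δ₂ c a b c⊥a))
               (∑³-δ₂δ₂ a b c a⊥b (⊥-sym b⊥c))))) ⟩
        1ℤ * N + (- 1ℤ * C + (- 1ℤ * A + (- 1ℤ * B + (+ 2 * 1ℤ + 0ℤ))))
          ≡⟨ lem N A B C ⟩
        N - C - A - B + + 2 ∎
        where
        lem : ∀ n a b c → 1ℤ * n + (- 1ℤ * c + (- 1ℤ * a + (- 1ℤ * b + (+ 2 * 1ℤ + 0ℤ)))) ≡ n - c - a - b + + 2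
        lem = solve-∀
        ones : ∀ a b c → c * (a * (b * 1ℤ)) ≡ a * b * c
        ones = solve-∀
        ∑ones : ∑³ a b c (λ _ _ _ → 1ℤ) ≡ N
        ∑ones = trans (∑³-const a b c (λ _ _ → 1ℤ)) (trans
          (cong (λ w → C * w) (trans (∑-cong a λ _ → ∑-const b 1ℤ) (∑-const a (B * 1ℤ)))) (ones A B C))

    -- This is the three-term relation times 12 N²: `D` modulo b already contains 4b², so the factor
    -- A² C² completes 4N², and likewise for the others.
    rademacher : + 3 * (A * A * (C * C) * D A C b + B * B * (A * A) * D B A c + C * C * (B * B) * D C B a)
      ≡ N * (A * A + B * B + C * C) - + 3 * (N * N)
    -- The 2 is the multiplicity of the mixed products in the square.
    rademacher = *-cancelˡ-≡ (+ 2) _ _ (begin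
      + 2 * (+ 3 * (A * A * (C * C) * D A C b + B * B * (A * A) * D B A c + C * C * (B * B) * D C B a))
        ≡⟨ lem₁ A B C (D A C b) (D B A c) (D C B a) Q ⟩
      + 3 * Q - + 3 * (1ℤ * Q + (+ 2 * - R + 0ℤ))
        ≡⟨ cong₂ (λ p t → p - + 3 * t) ∑squares ∑balance ⟩
      C * C * P A B C + (A * A * P B C A + B * B * P C A B) - + 3 * (N * N * (N - C - A - B + + 2) + 0ℤ)
        ≡⟨ lem₂ A B C ⟩
      + 2 * (N * (A * A + B * B + C * C) - + 3 * (N * N)) ∎)
      where
      Q = ∑³ a b c (combination squares)
      R = A * C * (A * C * D A C b) + B * A * (B * A * D B A c) + C * B * (C * B * D C B a)
      both = (1ℤ , combination squares) ∷ (+ 2 , combination mixed) ∷ []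
      lem₁ : ∀ a b c x y z q →
        + 2 * (+ 3 * (a * a * (c * c) * x + b * b * (a * a) * y + c * c * (b * b) * z))
        ≡ + 3 * q - + 3 * (1ℤ * q + (+ 2 * - (a * c * (a * c * x) + b * a * (b * a * y) + c * b * (c * b * z)) + 0ℤ))
      lem₁ = solve-∀
      lem₂ : ∀ a b c →
        c * c * (c * ((a * b) * (a * b - 1ℤ) * (a * b - + 2))) + (a * a * (a * ((b * c) * (b * c - 1ℤ) * (b * c - + 2)))
          + b * b * (b * ((c * a) * (c * a - 1ℤ) * (c * a - + 2))))
          - + 3 * (a * b * c * (a * b * c) * (a * b * c - c - a - b + + 2) + 0ℤ)
        ≡ + 2 * (a * b * c * (a * a + b * b + c * c) - + 3 * (a * b * c * (a * b * c)))
      lem₂ = solve-∀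
      ∑balance : 1ℤ * Q + (+ 2 * - R + 0ℤ) ≡ N * N * (N - C - A - B + + 2) + 0ℤ
      ∑balance = begin
        1ℤ * Q + (+ 2 * - R + 0ℤ)
          ≡⟨ cong (λ w → 1ℤ * Q + (+ 2 * w + 0ℤ)) (sym ∑mixed) ⟩
        1ℤ * Q + (+ 2 * ∑³ a b c (combination mixed) + 0ℤ)
          ≡⟨ sym (∑³-combination a b c both) ⟩
        ∑³ a b c (combination both)
          ≡⟨ ∑³-cong a b c balance ⟩
        ∑³ a b c (combination ((N * N , combination counts) ∷ []))
          ≡⟨ ∑³-combination a b c ((N * N , combination counts) ∷ []) ⟩
        N * N * ∑³ a b c (combination counts) + 0ℤ
          ≡⟨ cong (λ w → N * N * w + 0ℤ) ∑counts ⟩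
        N * N * (N - C - A - B + + 2) + 0ℤ ∎

-- Shifting the value of a Dedekind sum

D-comm : ∀ x y c → D x y c ≡ D y x c
D-comm x y c = ∑-cong c λ j → *-comm (σ c (x * + j)) (σ c (y * + j))

σ-cong-*ˡ : ∀ c x z j → σ c ((x + z * + c) * j) ≡ σ c (x * j)
σ-cong-*ˡ c x z j = trans (cong (σ c) (lem x z (+ c) j)) (σ-periodic c (x * j) (z * j))
  where
  lem : ∀ x z c j → (x + z * c) * j ≡ x * j + z * j * c
  lem = solve-∀

D-periodicˡ : ∀ x y c z → D (x + z * + c) y c ≡ D x y c
D-periodicˡ x y c z = ∑-cong c λ j → cong (_* σ c (y * + j)) (σ-cong-*ˡ c x z (+ j))

D-periodicʳ : ∀ x y c z → D x (y + z * + c) c ≡ D x y c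
D-periodicʳ x y c z = trans (D-comm x (y + z * + c) c) (trans (D-periodicˡ y x c z) (D-comm y x c))

D-negʳ : ∀ x y c → D x (- y) c ≡ - D x y c
D-negʳ x y c = trans (∑-cong c flip) (∑-neg c (λ j → σ c (x * + j) * σ c (y * + j)))
  where
  flip : ∀ j → σ c (x * + j) * σ c (- y * + j) ≡ - (σ c (x * + j) * σ c (y * + j))
  flip j = begin
    σ c (x * + j) * σ c (- y * + j)      ≡⟨ cong (λ w → σ c (x * + j) * σ c w) (sym (neg-distribˡ-* y (+ j))) ⟩
    σ c (x * + j) * σ c (- (y * + j))    ≡⟨ cong (λ w → σ c (x * + j) * w) (σ-neg c (y * + j)) ⟩
    σ c (x * + j) * - σ c (y * + j)      ≡⟨ sym (neg-distribʳ-* (σ c (x * + j)) (σ c (y * + j))) ⟩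
    - (σ c (x * + j) * σ c (y * + j))    ∎

D-unit : ∀ {u c} .{{_ : NonZero c}} x y → u ⊥ + c → D (u * x) (u * y) c ≡ D x y c
D-unit {u} {c} x y u⊥c = trans
  (∑-cong c λ j → cong₂ (λ v w → σ c v * σ c w) (lem u x (+ j)) (lem u y (+ j)))
  (∑-multiples {F = λ n → σ c (x * n) * σ c (y * n)} u⊥c λ n z → cong₂ _*_ (per x n z) (per y n z))
  where
  lem : ∀ u x j → u * x * j ≡ x * (u * j)
  lem = solve-∀
  lem′ : ∀ x n z c → x * (n + z * c) ≡ x * n + x * z * c
  lem′ = solve-∀
  per : ∀ x n z → σ c (x * (n + z * + c)) ≡ σ c (x * n)
  per x n z = trans (cong (σ c) (lem′ x n z (+ c))) (σ-periodic c (x * n) (x * z))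

D-one : ∀ x y → D x y 1 ≡ 0ℤ
D-one x y = trans (+-identityˡ _) (cong (λ r → ζ 1 r * σ 1 (y * 0ℤ)) (ℕ.n<1⇒n≡0 (rem< 1 (x * 0ℤ))))

-- Dedekind's reciprocity law times 12 a² b²; the sum modulo 1 vanishes.
reciprocity : ∀ a .{{_ : NonZero a}} b .{{_ : NonZero b}} → + a ⊥ + b →
  + b * + b * (+ 3 * D 1ℤ (+ b) a) + + a * + a * (+ 3 * D 1ℤ (+ a) b)
    ≡ + a * + b * (1ℤ + + a * + a + + b * + b - + 3 * (+ a * + b))
reciprocity a b a⊥b = begin
  B * B * (+ 3 * D 1ℤ B a) + A * A * (+ 3 * D 1ℤ A b)
    ≡⟨ lem₁ A B (D 1ℤ B a) (D 1ℤ A b) ⟩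
  + 3 * (1ℤ * 1ℤ * (B * B) * D 1ℤ B a + A * A * (1ℤ * 1ℤ) * D 1ℤ A b + B * B * (A * A) * 0ℤ)
    ≡⟨ cong₂ (λ x y → + 3 * (1ℤ * 1ℤ * (B * B) * D 1ℤ B a + A * A * (1ℤ * 1ℤ) * x + B * B * (A * A) * y))
         (D-comm 1ℤ A b) (sym (D-one B A)) ⟩
  + 3 * (1ℤ * 1ℤ * (B * B) * D 1ℤ B a + A * A * (1ℤ * 1ℤ) * D A 1ℤ b + B * B * (A * A) * D B A 1)
    ≡⟨ rademacher 1 a b ⊥-1ˡ a⊥b (⊥-sym ⊥-1ˡ) ⟩
  1ℤ * A * B * (1ℤ * 1ℤ + A * A + B * B) - + 3 * (1ℤ * A * B * (1ℤ * A * B))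
    ≡⟨ lem₂ A B ⟩
  A * B * (1ℤ + A * A + B * B - + 3 * (A * B)) ∎
  where
  A = + a
  B = + b
  lem₁ : ∀ a b x y → b * b * (+ 3 * x) + a * a * (+ 3 * y)
    ≡ + 3 * (1ℤ * 1ℤ * (b * b) * x + a * a * (1ℤ * 1ℤ) * y + b * b * (a * a) * 0ℤ)
  lem₁ = solve-∀
  lem₂ : ∀ a b → 1ℤ * a * b * (1ℤ * 1ℤ + a * a + b * b) - + 3 * (1ℤ * a * b * (1ℤ * a * b))
    ≡ a * b * (1ℤ + a * a + b * b - + 3 * (a * b))
  lem₂ = solve-∀

-- The denominator of a Dedekind sum

*-factor-ℕ : ∀ {n} m .{{_ : NonZero m}} {x} → + n ≡ + m * x → x ≡ + ∣ x ∣
*-factor-ℕ {n} m {x} n≡mx = *-cancelˡ-≡ (+ m) x (+ ∣ x ∣) {{ℤ.≢-nonZero λ eq → ℕ.≢-nonZero⁻¹ m (+-injective eq)}} (begin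
  + m * x                ≡⟨ sym n≡mx ⟩
  + n                    ≡⟨ cong (λ w → + ∣ w ∣) n≡mx ⟩
  + ∣ + m * x ∣          ≡⟨ cong +_ (abs-* (+ m) x) ⟩
  + (m ℕ.* ∣ x ∣)        ≡⟨ pos-* m ∣ x ∣ ⟩
  + m * + ∣ x ∣          ∎)

-- value says S(a, q t) = k / q.
record Presentation (q : ℕ) (k : ℤ) : Set where
  field
    a t m : ℕ
    {{a≢0}} : NonZero a
    {{t≢0}} : NonZero t
    {{m≢0}} : NonZero m
    a⊥q   : + a ⊥ + q
    m⊥q   : + m ⊥ + q
    tm≡   : + t * + m ≡ + a * + a + 1ℤ
    value : k * + q * (+ t * + t) ≡ + 3 * D 1ℤ (+ a) (q ℕ.* t)

pos≢0 : ∀ m .{{_ : NonZero m}} → ℤ.NonZero (+ m)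
pos≢0 (suc _) = _

nonZero-factorʳ : ∀ {n} m x .{{_ : NonZero n}} → n ≡ m ℕ.* x → NonZero x
nonZero-factorʳ {suc _} m zero    eq = contradiction (trans eq (ℕ.*-zeroʳ m)) λ()
nonZero-factorʳ         m (suc _) eq = _

-- If S(a,b) has reduced denominator q then b = q t with t = gcd(a² + 1, b).
present : ∀ q .{{_ : NonZero q}} {k} → k ⊥ + q → ∀ a .{{_ : NonZero a}} b .{{_ : NonZero b}} → + a ⊥ + b →
  k * (+ b * + b) ≡ + q * (+ 3 * D 1ℤ (+ a) b) → Presentation q k
present q {k} k⊥q a b a⊥b kbb≡ = record
  { a = a ; t = t ; m = m
  ; a≢0 = ℕ.>-nonZero (ℕ.>-nonZero⁻¹ a)
  ; t≢0 = nonZero-factorʳ q t b≡qt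
  ; m≢0 = nonZero-factorʳ {a ℕ.* a ℕ.+ 1} t m {{ℕ.>-nonZero (ℕ.m≤n+m 1 (a ℕ.* a))}}
      (+-injective (trans aa+1 (trans (sym tm≡) (sym (pos-* t m)))))
  ; a⊥q = a⊥q
  ; m⊥q = subst (_⊥ Q) μ≡ μ⊥q
  ; tm≡ = tm≡
  ; value = begin
      k * Q * (T * T)         ≡⟨ lem k Q T ⟩
      Q * T * (k * T)         ≡⟨ cong₂ _*_ (sym B≡QT) (sym n≡kT) ⟩
      B * n                   ≡⟨ sym (proj₂ X-div) ⟩
      + 3 * D 1ℤ A b          ≡⟨ cong (λ c → + 3 * D 1ℤ A c) b≡qt ⟩
      + 3 * D 1ℤ A (q ℕ.* t)  ∎
  }
  where
  instance
    _ = pos≢0 a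
    _ = pos≢0 b
    _ = pos≢0 q
  A = + a
  B = + b
  Q = + q
  X = + 3 * D 1ℤ A b
  Y = + 3 * D 1ℤ B a
  recip = reciprocity a b a⊥b
  X-div : ∃ λ n → X ≡ B * n
  X-div = ⊥-cancelˡ (⊥-*ˡ a⊥b a⊥b) (begin
    A * A * X                                                   ≡⟨ lem₁ (A * A * X) (B * B * Y) ⟩
    B * B * Y + A * A * X - B * B * Y                           ≡⟨ cong (_- B * B * Y) recip ⟩
    A * B * (1ℤ + A * A + B * B - + 3 * (A * B)) - B * B * Y    ≡⟨ lem₂ A B Y ⟩
    B * (A * (1ℤ + A * A + B * B - + 3 * (A * B)) - B * Y)      ∎)
    where
    lem₁ : ∀ x y → x ≡ y + x - y
    lem₁ = solve-∀
    lem₂ : ∀ a b y → a * b * (1ℤ + a * a + b * b - + 3 * (a * b)) - b * b * y ≡ b * (a * (1ℤ + a * a + b * b - + 3 * (a * b)) - b * y)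
    lem₂ = solve-∀
  Y-div : ∃ λ n → Y ≡ A * n
  Y-div = ⊥-cancelˡ (⊥-*ˡ (⊥-sym a⊥b) (⊥-sym a⊥b)) (begin
    B * B * Y                                                   ≡⟨ lem₁ (B * B * Y) (A * A * X) ⟩
    B * B * Y + A * A * X - A * A * X                           ≡⟨ cong (_- A * A * X) recip ⟩
    A * B * (1ℤ + A * A + B * B - + 3 * (A * B)) - A * A * X    ≡⟨ lem₂ A B X ⟩
    A * (B * (1ℤ + A * A + B * B - + 3 * (A * B)) - A * X)      ∎)
    where
    lem₁ : ∀ x y → x ≡ x + y - y
    lem₁ = solve-∀
    lem₂ : ∀ a b y → a * b * (1ℤ + a * a + b * b - + 3 * (a * b)) - a * a * y ≡ a * (b * (1ℤ + a * a + b * b - + 3 * (a * b)) - a * y)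
    lem₂ = solve-∀
  n = proj₁ X-div
  l = proj₁ Y-div
  kb≡qn : k * B ≡ Q * n
  kb≡qn = *-cancelˡ-≡ B (k * B) (Q * n) (begin
    B * (k * B)    ≡⟨ lem₁ k B ⟩
    k * (B * B)    ≡⟨ kbb≡ ⟩
    Q * X          ≡⟨ cong (λ w → Q * w) (proj₂ X-div) ⟩
    Q * (B * n)    ≡⟨ lem₂ Q B n ⟩
    B * (Q * n)    ∎)
    where
    lem₁ : ∀ k b → b * (k * b) ≡ k * (b * b)
    lem₁ = solve-∀
    lem₂ : ∀ q b n → q * (b * n) ≡ b * (q * n)
    lem₂ = solve-∀
  -- As k is prime to q, the equation k b = q n makes q divide b.
  B-div : ∃ λ w → B ≡ Q * w
  B-div = ⊥-cancelˡ k⊥q kb≡qn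
  t = ∣ proj₁ B-div ∣
  T = + t
  B≡QT : B ≡ Q * T
  B≡QT = trans (proj₂ B-div) (cong (λ w → Q * w) (*-factor-ℕ q (proj₂ B-div)))
  b≡qt : b ≡ q ℕ.* t
  b≡qt = +-injective (trans B≡QT (sym (pos-* q t)))
  instance
    t≢0 : NonZero t
    t≢0 = nonZero-factorʳ q t b≡qt
  n≡kT : n ≡ k * T
  n≡kT = *-cancelˡ-≡ Q n (k * T) (begin
    Q * n          ≡⟨ sym kb≡qn ⟩
    k * B          ≡⟨ cong (λ w → k * w) B≡QT ⟩
    k * (Q * T)    ≡⟨ lem k Q T ⟩
    Q * (k * T)    ∎)
    where
    lem : ∀ k q t → k * (q * t) ≡ q * (k * t)
    lem = solve-∀
  -- Reciprocity divided by ab reads t k a + b l = 1 + a² + b² - 3ab. Solving for a² + 1 and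
  -- inserting b = q t gives t (k a + z q), whose second factor is `μ`.
  z = l - B + + 3 * A
  μ = k * A + z * Q
  Tμ≡ : A * A + 1ℤ ≡ T * μ
  Tμ≡ = *-cancelˡ-≡ (A * B) (A * A + 1ℤ) (T * μ) {{i*j≢0 A B}} (begin
    A * B * (A * A + 1ℤ)
      ≡⟨ lem₁ A B ⟩
    A * B * (1ℤ + A * A + B * B - + 3 * (A * B)) + A * B * B * (+ 3 * A - B)
      ≡⟨ cong (_+ A * B * B * (+ 3 * A - B)) (sym recip) ⟩
    B * B * Y + A * A * X + A * B * B * (+ 3 * A - B)
      ≡⟨ cong₂ (λ x y → B * B * y + A * A * x + A * B * B * (+ 3 * A - B)) (trans (proj₂ X-div) (cong (λ w → B * w) n≡kT)) (proj₂ Y-div) ⟩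
    B * B * (A * l) + A * A * (B * (k * T)) + A * B * B * (+ 3 * A - B)
      ≡⟨ lem₂ A B k T l ⟩
    A * B * (T * (k * A) + z * B)
      ≡⟨ cong (λ w → A * B * (T * (k * A) + z * w)) B≡QT ⟩
    A * B * (T * (k * A) + z * (Q * T))
      ≡⟨ lem₃ (A * B) (k * A) Q T z ⟩
    A * B * (T * μ) ∎)
    where
    lem₁ : ∀ a b → a * b * (a * a + 1ℤ) ≡ a * b * (1ℤ + a * a + b * b - + 3 * (a * b)) + a * b * b * (+ 3 * a - b)
    lem₁ = solve-∀
    lem₂ : ∀ a b k t l → b * b * (a * l) + a * a * (b * (k * t)) + a * b * b * (+ 3 * a - b) ≡ a * b * (t * (k * a) + (l - b + + 3 * a) * b)
    lem₂ = solve-∀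
    lem₃ : ∀ c x q t z → c * (t * x + z * (q * t)) ≡ c * (t * (x + z * q))
    lem₃ = solve-∀
  a⊥q : A ⊥ Q
  a⊥q = ⊥-factorʳ (subst (A ⊥_) B≡QT a⊥b)
  μ⊥q : μ ⊥ Q
  μ⊥q = ⊥-+-*ˡ z (⊥-*ˡ k⊥q a⊥q)
  m = ∣ μ ∣
  aa+1 : + (a ℕ.* a ℕ.+ 1) ≡ A * A + 1ℤ
  aa+1 = cong (_+ 1ℤ) (pos-* a a)
  μ≡ : μ ≡ + m
  μ≡ = *-factor-ℕ t (trans aa+1 Tμ≡)
  tm≡ : T * + m ≡ A * A + 1ℤ
  tm≡ = trans (cong (λ w → T * w) (sym μ≡)) (sym Tμ≡)
  lem : ∀ k q t → k * q * (t * t) ≡ q * t * (k * t)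
  lem = solve-∀

-- The value of S(a, q t) in terms of sums modulo q and m

module _ (q t m a : ℕ) .{{q≢0 : NonZero q}} .{{t≢0 : NonZero t}} .{{m≢0 : NonZero m}} .{{a≢0 : NonZero a}}
  (a⊥q : + a ⊥ + q) (m⊥q : + m ⊥ + q) (tm≡ : + t * + m ≡ + a * + a + 1ℤ) where

  private
    A = + a
    M = + m
    T = + t
    Q = + q
    B = Q * T
    b = q ℕ.* t
    B≡ : + b ≡ B
    B≡ = pos-* q t
    Cq = + 3 * D A M q
    Cm = + 3 * D Q A m
    X = + 3 * D 1ℤ A b
    Y = + 3 * D M Q a
    instance
      _ = ℕ.m*n≢0 q t
      _ = pos≢0 a
      _ = pos≢0 q
      _ = i*j≢0 Q A

    a⊥tm : ∀ {x y} → x * y ≡ A * A + 1ℤ → A ⊥ x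
    a⊥tm {x} {y} xy≡ = - A , y , (begin
      - A * A + y * x             ≡⟨ cong (λ w → - A * A + w) (trans (*-comm y x) xy≡) ⟩
      - A * A + (A * A + 1ℤ)      ≡⟨ lem A ⟩
      1ℤ                          ∎)
      where
      lem : ∀ a → - a * a + (a * a + 1ℤ) ≡ 1ℤ
      lem = solve-∀

    a⊥m : A ⊥ M
    a⊥m = a⊥tm (trans (*-comm M T) tm≡)

  a⊥qt : A ⊥ + b
  a⊥qt = subst (A ⊥_) (sym B≡) (⊥-sym (⊥-*ˡ (⊥-sym a⊥q) (⊥-sym (a⊥tm tm≡))))

  private
    -- Both arguments are multiplied by the unit m, and m q t = q (a² + 1) is q modulo a. The sum
    -- modulo a in `recip` is now the one in `three`.
    Y≡ : + 3 * D 1ℤ (+ b) a ≡ Y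
    Y≡ = cong (λ w → + 3 * w) (begin
      D 1ℤ (+ b) a                  ≡⟨ sym (D-unit 1ℤ (+ b) (⊥-sym a⊥m)) ⟩
      D (M * 1ℤ) (M * + b) a        ≡⟨ cong₂ (λ x y → D x y a) (*-identityʳ M) reduce ⟩
      D M (Q + Q * A * A) a         ≡⟨ D-periodicʳ M Q a (Q * A) ⟩
      D M Q a                       ∎)
      where
      lem₁ : ∀ m q t → m * (q * t) ≡ q * (t * m)
      lem₁ = solve-∀
      lem₂ : ∀ q a → q * (a * a + 1ℤ) ≡ q + q * a * a
      lem₂ = solve-∀
      reduce : M * + b ≡ Q + Q * A * A
      reduce = begin
        M * + b              ≡⟨ cong (λ w → M * w) B≡ ⟩
        M * (Q * T)          ≡⟨ lem₁ M Q T ⟩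
        Q * (T * M)          ≡⟨ cong (λ w → Q * w) tm≡ ⟩
        Q * (A * A + 1ℤ)     ≡⟨ lem₂ Q A ⟩
        Q + Q * A * A        ∎

    recip : B * B * Y + A * A * X ≡ A * B * (1ℤ + A * A + B * B - + 3 * (A * B))
    recip = begin
      B * B * Y + A * A * X              ≡⟨ cong (λ y → B * B * y + A * A * X) (sym Y≡) ⟩
      B * B * Y′ + A * A * X             ≡⟨ cong (λ w → w * w * Y′ + A * A * X) (sym B≡) ⟩
      + b * + b * Y′ + A * A * X         ≡⟨ reciprocity a b a⊥qt ⟩
      A * + b * (1ℤ + A * A + + b * + b - + 3 * (A * + b))
                                         ≡⟨ cong (λ w → A * w * (1ℤ + A * A + w * w - + 3 * (A * w))) B≡ ⟩
      A * B * (1ℤ + A * A + B * B - + 3 * (A * B)) ∎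
      where Y′ = + 3 * D 1ℤ (+ b) a

    three : Q * Q * (A * A) * Cm + M * M * (Q * Q) * Y + A * A * (M * M) * Cq
      ≡ Q * M * A * (Q * Q + M * M + A * A) - + 3 * (Q * M * A * (Q * M * A))
    three = trans (lem (Q * Q * (A * A)) (M * M * (Q * Q)) (A * A * (M * M)) (D Q A m) (D M Q a) (D A M q))
      (rademacher q m a (⊥-sym m⊥q) (⊥-sym a⊥m) a⊥q)
      where
      lem : ∀ x y z u v w → x * (+ 3 * u) + y * (+ 3 * v) + z * (+ 3 * w) ≡ + 3 * (x * u + y * v + z * w)
      lem = solve-∀

  -- The formula for S(a, q t), cleared of denominators.
  evaluate : M * M * X ≡ T * T * (A * Q * M * (Q * Q - 1ℤ) + (M * M * Cq + Q * Q * Cm))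
  evaluate = *-cancelˡ-≡ (Q * A * (Q * A)) _ _ {{i*j≢0 (Q * A) (Q * A)}} (begin
    Q * A * (Q * A) * (M * M * X)
      -- The multipliers of `recip` and `three` give Y the same coefficient B² M² Q², so it cancels;
      -- the last summand restores the sums modulo q and m.
      ≡⟨ lem₁ Q A M T X Y Cq Cm ⟩
    Q * Q * (M * M) * (B * B * Y + A * A * X)
      - B * B * (Q * Q * (A * A) * Cm + M * M * (Q * Q) * Y + A * A * (M * M) * Cq)
      + B * B * (A * A) * K
      ≡⟨ cong₂ (λ u v → Q * Q * (M * M) * u - B * B * v + B * B * (A * A) * K) recip three ⟩
    Q * Q * (M * M) * (A * B * (1ℤ + A * A + B * B - + 3 * (A * B)))
      - B * B * (Q * M * A * (Q * Q + M * M + A * A) - + 3 * (Q * M * A * (Q * M * A)))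
      + B * B * (A * A) * K
      ≡⟨ lem₂ Q A M T K ⟩
    Q * A * (Q * A) * (T * T * (A * Q * M * (Q * Q - 1ℤ) + K)) + (A * A + 1ℤ - T * M) * W
      ≡⟨ cong (λ w → Q * A * (Q * A) * (T * T * (A * Q * M * (Q * Q - 1ℤ) + K)) + (A * A + 1ℤ - w) * W) tm≡ ⟩
    Q * A * (Q * A) * (T * T * (A * Q * M * (Q * Q - 1ℤ) + K)) + (A * A + 1ℤ - (A * A + 1ℤ)) * W
      ≡⟨ lem₃ (Q * A * (Q * A) * (T * T * (A * Q * M * (Q * Q - 1ℤ) + K))) (A * A + 1ℤ) W ⟩
    Q * A * (Q * A) * (T * T * (A * Q * M * (Q * Q - 1ℤ) + K)) ∎)
    where
    K = M * M * Cq + Q * Q * Cm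
    -- The formula holds only modulo the relation t m = a² + 1, and `W` is the cofactor of that
    -- relation.
    W = Q * Q * Q * (A * M * T) * (M - Q * Q * T)
    lem₁ : ∀ q a m t x y cq cm → q * a * (q * a) * (m * m * x)
      ≡ q * q * (m * m) * (q * t * (q * t) * y + a * a * x)
        - q * t * (q * t) * (q * q * (a * a) * cm + m * m * (q * q) * y + a * a * (m * m) * cq)
        + q * t * (q * t) * (a * a) * (m * m * cq + q * q * cm)
    lem₁ = solve-∀
    lem₂ : ∀ q a m t k →
      q * q * (m * m) * (a * (q * t) * (1ℤ + a * a + q * t * (q * t) - + 3 * (a * (q * t))))
        - q * t * (q * t) * (q * m * a * (q * q + m * m + a * a) - + 3 * (q * m * a * (q * m * a)))
        + q * t * (q * t) * (a * a) * k
      ≡ q * a * (q * a) * (t * t * (a * q * m * (q * q - 1ℤ) + k)) + (a * a + 1ℤ - t * m) * (q * q * q * (a * m * t) * (m - q * q * t))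
    lem₂ = solve-∀
    lem₃ : ∀ x y w → x + (y - y) * w ≡ x
    lem₃ = solve-∀

-- After division by t², `evaluate` no longer involves t: it is linear in a except for `K`, which is
-- periodic in a. The linear part grows by the required amount.
shift : ∀ q .{{_ : NonZero q}} {k} → Presentation q k → ∀ n → Presentation q (k + + n * (+ q * (+ q * + q - 1ℤ)))
shift q {k} p n = record
  { a = a′ ; t = t′ ; m = m
  ; m≢0 = m≢0
  ; a⊥q = a′⊥q ; m⊥q = m⊥q ; tm≡ = tm≡′
  ; value = *-cancelˡ-≡ (M * M) _ _ {{i*j≢0 M M}} (begin
      M * M * ((k + N * (Q * (Q * Q - 1ℤ))) * Q * (T′ * T′))
        ≡⟨ lem₁ M k N Q T′ ⟩
      T′ * T′ * (M * M * (k * Q) + N * M * Q * (Q * M * (Q * Q - 1ℤ)))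
        ≡⟨ cong (λ w → T′ * T′ * (w + N * M * Q * (Q * M * (Q * Q - 1ℤ)))) old ⟩
      T′ * T′ * (A * Q * M * (Q * Q - 1ℤ) + K A + N * M * Q * (Q * M * (Q * Q - 1ℤ)))
        ≡⟨ lem₂ M N Q T′ A (K A) ⟩
      T′ * T′ * ((A + N * M * Q) * Q * M * (Q * Q - 1ℤ) + K A)
        ≡⟨ cong₂ (λ x y → T′ * T′ * (x * Q * M * (Q * Q - 1ℤ) + y)) (sym a′≡) (sym (trans (cong K a′≡) K-periodic)) ⟩
      T′ * T′ * (+ a′ * Q * M * (Q * Q - 1ℤ) + K (+ a′))
        ≡⟨ sym (evaluate q t′ m a′ a′⊥q m⊥q tm≡′) ⟩
      M * M * (+ 3 * D 1ℤ (+ a′) (q ℕ.* t′)) ∎)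
  }
  where
  open Presentation p
  a′ = a ℕ.+ n ℕ.* m ℕ.* q
  -- Moving a by n q m raises a² + 1 by n q m (2a + n q m); division by m gives the increment of t.
  t′ = t ℕ.+ n ℕ.* q ℕ.* (2 ℕ.* a ℕ.+ n ℕ.* q ℕ.* m)
  instance
    a′≢0 : NonZero a′
    a′≢0 = ℕ.>-nonZero (ℕ.≤-trans (ℕ.>-nonZero⁻¹ a) (ℕ.m≤m+n a _))
    t′≢0 : NonZero t′
    t′≢0 = ℕ.>-nonZero (ℕ.≤-trans (ℕ.>-nonZero⁻¹ t) (ℕ.m≤m+n t _))
    _ = pos≢0 m
    _ = pos≢0 t
  A = + a
  M = + m
  T = + t
  Q = + q
  N = + n
  T′ = + t′
  K : ℤ → ℤ
  K x = M * M * (+ 3 * D x M q) + Q * Q * (+ 3 * D Q x m)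
  a′≡ : + a′ ≡ A + N * M * Q
  a′≡ = cong (λ w → A + w) (trans (pos-* (n ℕ.* m) q) (cong (_* Q) (pos-* n m)))
  nq≡ : + (n ℕ.* q) ≡ N * Q
  nq≡ = pos-* n q
  t′≡ : T′ ≡ T + N * Q * (+ 2 * A + N * Q * M)
  t′≡ = cong (λ w → T + w) (trans (pos-* (n ℕ.* q) _) (cong₂ _*_ nq≡
    (cong₂ _+_ (pos-* 2 a) (trans (pos-* (n ℕ.* q) m) (cong (_* M) nq≡)))))
  a′⊥q : + a′ ⊥ Q
  a′⊥q = subst (_⊥ Q) (sym a′≡) (⊥-+-*ˡ (N * M) a⊥q)
  lem₀ : ∀ a m t q n → (t + n * q * (+ 2 * a + n * q * m)) * m ≡ t * m + (n * m * q) * (+ 2 * a + n * m * q)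
  lem₀ = solve-∀
  lem₀′ : ∀ a d → a * a + 1ℤ + d * (+ 2 * a + d) ≡ (a + d) * (a + d) + 1ℤ
  lem₀′ = solve-∀
  tm≡′ : T′ * M ≡ + a′ * + a′ + 1ℤ
  tm≡′ = begin
    T′ * M                                                 ≡⟨ cong (_* M) t′≡ ⟩
    (T + N * Q * (+ 2 * A + N * Q * M)) * M                ≡⟨ lem₀ A M T Q N ⟩
    T * M + (N * M * Q) * (+ 2 * A + N * M * Q)            ≡⟨ cong (_+ (N * M * Q) * (+ 2 * A + N * M * Q)) tm≡ ⟩
    A * A + 1ℤ + (N * M * Q) * (+ 2 * A + N * M * Q)       ≡⟨ lem₀′ A (N * M * Q) ⟩
    (A + N * M * Q) * (A + N * M * Q) + 1ℤ                 ≡⟨ cong (λ w → w * w + 1ℤ) (sym a′≡) ⟩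
    + a′ * + a′ + 1ℤ                                       ∎
  lem₁ : ∀ m k n q t → m * m * ((k + n * (q * (q * q - 1ℤ))) * q * (t * t)) ≡ t * t * (m * m * (k * q) + n * m * q * (q * m * (q * q - 1ℤ)))
  lem₁ = solve-∀
  lem₂ : ∀ m n q t a x → t * t * (a * q * m * (q * q - 1ℤ) + x + n * m * q * (q * m * (q * q - 1ℤ))) ≡ t * t * ((a + n * m * q) * q * m * (q * q - 1ℤ) + x)
  lem₂ = solve-∀
  lem₃ : ∀ m k q t → t * t * (m * m * (k * q)) ≡ m * m * (k * q * (t * t))
  lem₃ = solve-∀
  lem₄ : ∀ n m q → n * m * q ≡ n * q * m
  lem₄ = solve-∀
  old : M * M * (k * Q) ≡ A * Q * M * (Q * Q - 1ℤ) + K A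
  old = *-cancelˡ-≡ (T * T) _ _ {{i*j≢0 T T}} (trans (lem₃ M k Q T)
    (trans (cong (λ w → M * M * w) value) (evaluate q t m a a⊥q m⊥q tm≡)))
  K-periodic : K (A + N * M * Q) ≡ K A
  K-periodic = cong₂ (λ x y → M * M * (+ 3 * x) + Q * Q * (+ 3 * y))
    (D-periodicˡ A M q (N * M))
    (trans (cong (λ w → D Q (A + w) m) (lem₄ N M Q)) (D-periodicʳ Q A m (N * Q)))

-- k / q = S(a,b) with the denominators cleared.
IntegralValue : ℕ → ℤ → Set
IntegralValue q k = Σ ℤ λ a → Σ ℕ λ b → NonZero b × a ⊥ + b × k * (+ b * + b) ≡ + q * (+ 3 * D 1ℤ a b)

presentation⇒value : ∀ {q k} .{{_ : NonZero q}} → Presentation q k → IntegralValue q k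
presentation⇒value {q} {k} p = + a , b , ℕ.m*n≢0 q t , a⊥qt q t m a a⊥q m⊥q tm≡ , (begin
    k * (+ b * + b)                 ≡⟨ cong (λ w → k * (w * w)) (pos-* q t) ⟩
    k * (Q * + t * (Q * + t))       ≡⟨ lem k Q (+ t) ⟩
    Q * (k * Q * (+ t * + t))       ≡⟨ cong (λ w → Q * w) value ⟩
    Q * (+ 3 * D 1ℤ (+ a) b)        ∎)
  where
  open Presentation p
  Q = + q
  b = q ℕ.* t
  lem : ∀ k q t → k * (q * t * (q * t)) ≡ q * (k * q * (t * t))
  lem = solve-∀

value⇒presentation : ∀ {q k} .{{_ : NonZero q}} → k ⊥ + q → IntegralValue q k → Presentation q k
value⇒presentation {q} k⊥q (a , b , b≢0 , a⊥b , eq) =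
  present q k⊥q a′ b (subst (_⊥ + b) (sym a′≡) (⊥-+-*ˡ z a⊥b)) (trans eq (cong (λ w → + q * (+ 3 * w)) (sym D≡)))
  where
  instance
    _ = b≢0
  -- A positive representative of a is needed, and the residue alone is 0 when b = 1.
  a′ = rem b a ℕ.+ b
  instance
    a′≢0 : NonZero a′
    a′≢0 = ℕ.>-nonZero (ℕ.≤-trans (ℕ.>-nonZero⁻¹ b) (ℕ.m≤n+m b (rem b a)))
  z = 1ℤ - proj₁ (rem-eq b a)
  lem : ∀ r w b → r + w * b + (1ℤ - w) * b ≡ r + b
  lem = solve-∀
  a′≡ : + a′ ≡ a + z * + b
  a′≡ = sym (trans (cong (_+ z * + b) (proj₂ (rem-eq b a))) (lem (+ rem b a) (proj₁ (rem-eq b a)) (+ b)))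
  D≡ : D 1ℤ (+ a′) b ≡ D 1ℤ a b
  D≡ = trans (cong (λ w → D 1ℤ w b) a′≡) (D-periodicʳ 1ℤ a b z)

value-shift : ∀ q .{{_ : NonZero q}} {k} → k ⊥ + q → IntegralValue q k → ∀ n →
  IntegralValue q (k + + n * (+ q * (+ q * + q - 1ℤ)))
value-shift q k⊥q v n = presentation⇒value (shift q (value⇒presentation k⊥q v) n)

value-neg : ∀ q k → IntegralValue q k → IntegralValue q (- k)
value-neg q k (a , b , b≢0 , a⊥b , eq) = - a , b , b≢0 , ⊥-negˡ a⊥b , (begin
  - k * (+ b * + b)                   ≡⟨ sym (neg-distribˡ-* k (+ b * + b)) ⟩
  - (k * (+ b * + b))                 ≡⟨ cong -_ eq ⟩
  - (+ q * (+ 3 * D 1ℤ a b))          ≡⟨ lem (+ q) (D 1ℤ a b) ⟩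
  + q * (+ 3 * - D 1ℤ a b)            ≡⟨ cong (λ w → + q * (+ 3 * w)) (sym (D-negʳ 1ℤ a b)) ⟩
  + q * (+ 3 * D 1ℤ (- a) b)          ∎)
  where
  lem : ∀ q x → - (q * (+ 3 * x)) ≡ q * (+ 3 * - x)
  lem = solve-∀

value-translate : ∀ q .{{_ : NonZero q}} {k} → k ⊥ + q → IntegralValue q k → ∀ z →
  IntegralValue q (k + z * (+ q * (+ q * + q - 1ℤ)))
value-translate q k⊥q v (+ n) = value-shift q k⊥q v n
-- Lowering a could leave the positive integers, so -k is raised instead.
value-translate q {k} k⊥q v -[1+ n ] = subst (IntegralValue q) (lem k (+ suc n) (+ q * (+ q * + q - 1ℤ)))
  (value-neg q (- k + + suc n * (+ q * (+ q * + q - 1ℤ))) (value-shift q (⊥-negˡ k⊥q) (value-neg q k v) (suc n)))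
  where
  lem : ∀ k n c → - (- k + n * c) ≡ k + - n * c
  lem = solve-∀

-- Rational values

⊥⇒Coprime : ∀ {a b} → a ⊥ + b → Coprime ∣ a ∣ b
⊥⇒Coprime {a} {b} (u , v , eq) {d} (d∣a , d∣b) with ∣ᵤ⇒∣ {+ d} {a} d∣a | ∣ᵤ⇒∣ {+ d} {+ b} d∣b
... | divides x a≡ | divides y b≡ = ℕ.∣1⇒≡1 (ℕ.divides ∣ u * x + v * y ∣ (begin
  1                                       ≡⟨ cong ∣_∣ (sym eq) ⟩
  ∣ u * a + v * + b ∣                     ≡⟨ cong₂ (λ s t → ∣ u * s + v * t ∣) a≡ b≡ ⟩
  ∣ u * (x * + d) + v * (y * + d) ∣       ≡⟨ cong ∣_∣ (lem u v x y (+ d)) ⟩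
  ∣ (u * x + v * y) * + d ∣               ≡⟨ abs-* (u * x + v * y) (+ d) ⟩
  ∣ u * x + v * y ∣ ℕ.* d                 ∎))
  where
  lem : ∀ u v x y d → u * (x * d) + v * (y * d) ≡ (u * x + v * y) * d
  lem = solve-∀

toℚᵘ-/ : ∀ x n .{{_ : NonZero n}} → toℚᵘ (x / n) ≃ x ℚᵘ./ n
toℚᵘ-/ x (suc n) = toℚᵘ-fromℚᵘ (mkℚᵘ x n)

≃-cross : ∀ {x y m n} .{{_ : NonZero m}} .{{_ : NonZero n}} → x * + n ≡ y * + m → x ℚᵘ./ m ≃ y ℚᵘ./ n
≃-cross {m = suc _} {n = suc _} = *≡*

ζ-pos : ∀ c r → r ≢ 0 → ζ c r ≡ + 2 * + r - + c
ζ-pos c zero    r≢0 = contradiction refl r≢0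
ζ-pos c (suc _) _   = refl

-- In lowest terms, denominator 1 is exactly the case of residue 0, so the branches of `saw` and `ζ`
-- agree.
saw-reduced : ∀ n d-1 .(c : Coprime ∣ n ∣ (suc d-1)) →
  toℚᵘ (saw (mkℚ n d-1 c)) ≃ σ (suc d-1) n ℚᵘ./ (2 ℕ.* suc d-1)
saw-reduced n zero c = ℚᵘ.≃-trans {j = mkℚᵘ 0ℤ 1} (*≡* refl)
  (ℚᵘ.≃-reflexive (cong (λ r → ζ 1 r ℚᵘ./ 2) (sym (ℕ.n<1⇒n≡0 (rem< 1 n)))))
saw-reduced n d-1@(suc d-2) c = begin≃
  toℚᵘ (p ℚ.- f / 1 ℚ.- ½)
    ≈⟨ toℚᵘ-homo-+ (p ℚ.- f / 1) (ℚ.- ½) ⟩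
  toℚᵘ (p ℚ.- f / 1) ℚᵘ.+ mkℚᵘ (- 1ℤ) 1
    ≈⟨ ℚᵘ.+-congˡ (mkℚᵘ (- 1ℤ) 1) (toℚᵘ-homo-+ p (ℚ.- (f / 1))) ⟩
  mkℚᵘ n d-1 ℚᵘ.+ toℚᵘ (ℚ.- (f / 1)) ℚᵘ.+ mkℚᵘ (- 1ℤ) 1
    ≈⟨ ℚᵘ.+-congˡ (mkℚᵘ (- 1ℤ) 1) (ℚᵘ.+-congʳ (mkℚᵘ n d-1)
         (ℚᵘ.≃-trans (toℚᵘ-homo‿- (f / 1)) (ℚᵘ.-‿cong (toℚᵘ-/ f 1)))) ⟩
  mkℚᵘ n d-1 ℚᵘ.+ mkℚᵘ (- f) 0 ℚᵘ.+ mkℚᵘ (- 1ℤ) 1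
    ≈⟨ *≡* cross ⟩
  σ d n ℚᵘ./ (2 ℕ.* d) ∎≃
  where
  open ℚᵘ.≃-Reasoning using (step-≈-⟩) renaming (begin_ to begin≃_; _∎ to _∎≃)
  d = suc d-1
  p = mkℚ n d-1 c
  f = floor p
  r = rem d n
  f≡ : f ≡ n ℤ./ℕ d
  f≡ = *-identityˡ (n ℤ./ℕ d)
  n≡ : n ≡ + r + f * + d
  n≡ = trans (a≡a%ℕn+[a/ℕn]*n n d) (cong (λ w → + r + w * + d) (sym f≡))
  r≢0 : r ≢ 0
  -- Residue 0 would make d a common divisor of n and d, hence 1, but here d is at least 2.
  r≢0 r≡0 = ℕ.1+n≢0 (ℕ.suc-injective (recompute (d ℕ.≟ 1) (c (d∣n , ℕ.∣-refl))))
    where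
    d∣n : d ℕ.∣ ∣ n ∣
    d∣n = ℕ.divides ∣ f ∣ (begin
      ∣ n ∣                ≡⟨ cong ∣_∣ n≡ ⟩
      ∣ + r + f * + d ∣    ≡⟨ cong (λ w → ∣ + w + f * + d ∣) r≡0 ⟩
      ∣ 0ℤ + f * + d ∣     ≡⟨ cong ∣_∣ (+-identityˡ (f * + d)) ⟩
      ∣ f * + d ∣          ≡⟨ abs-* f (+ d) ⟩
      ∣ f ∣ ℕ.* d          ∎)
  σ≡ : σ d n ≡ + 2 * + r - + d
  σ≡ = ζ-pos d r r≢0
  2d≡ : + (2 ℕ.* d) ≡ + 2 * + d
  2d≡ = pos-* 2 d
  den≡ : + (d ℕ.* 1 ℕ.* 2) ≡ + d * + 2
  den≡ = trans (pos-* (d ℕ.* 1) 2) (cong (λ w → + w * + 2) (ℕ.*-identityʳ d))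
  lem : ∀ r f d → ((r + f * d) * 1ℤ + - f * d) * + 2 + - 1ℤ * d ≡ + 2 * r - d
  lem = solve-∀
  lem′ : ∀ x d → x * (+ 2 * d) ≡ x * (d * + 2)
  lem′ = solve-∀
  cross : ((n * 1ℤ + - f * + d) * + 2 + - 1ℤ * + (d ℕ.* 1)) * + (2 ℕ.* d) ≡ σ d n * + (d ℕ.* 1 ℕ.* 2)
  cross = begin
    ((n * 1ℤ + - f * + d) * + 2 + - 1ℤ * + (d ℕ.* 1)) * + (2 ℕ.* d)
      ≡⟨ cong₂ (λ w v → ((n * 1ℤ + - f * + d) * + 2 + - 1ℤ * + w) * v) (ℕ.*-identityʳ d) 2d≡ ⟩
    ((n * 1ℤ + - f * + d) * + 2 + - 1ℤ * + d) * (+ 2 * + d)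
      ≡⟨ cong (λ w → ((w * 1ℤ + - f * + d) * + 2 + - 1ℤ * + d) * (+ 2 * + d)) n≡ ⟩
    (((+ r + f * + d) * 1ℤ + - f * + d) * + 2 + - 1ℤ * + d) * (+ 2 * + d)
      ≡⟨ cong (_* (+ 2 * + d)) (trans (lem (+ r) f (+ d)) (sym σ≡)) ⟩
    σ d n * (+ 2 * + d)
      ≡⟨ trans (lem′ (σ d n) (+ d)) (cong (λ w → σ d n * w) (sym den≡)) ⟩
    σ d n * + (d ℕ.* 1 ℕ.* 2) ∎

-- The fraction is first reduced by the common factor g, and `σ-scale` reinstates g.
saw-/ : ∀ x b .{{_ : NonZero b}} .{{_ : NonZero (2 ℕ.* b)}} → toℚᵘ (saw (x / b)) ≃ σ b x ℚᵘ./ (2 ℕ.* b)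
saw-/ x b = go (x / b) (↥-/ x b) (↧-/ x b)
  where
  g : ℕ
  g = ∣ ℤ.gcd x (+ b) ∣
  go : ∀ p → ↥ p * + g ≡ x → ↧ p * + g ≡ + b → toℚᵘ (saw p) ≃ σ b x ℚᵘ./ (2 ℕ.* b)
  go (mkℚ n d-1 c) num den = ℚᵘ.≃-trans (saw-reduced n d-1 c) (scale b≡)
    where
    d = suc d-1
    b≡ : b ≡ g ℕ.* d
    b≡ = +-injective (trans (sym den) (trans (*-comm (+ d) (+ g)) (sym (pos-* g d))))
    instance
      g≢0 : NonZero g
      g≢0 = ℕ.m*n≢0⇒m≢0 g {d} {{subst NonZero b≡ (ℕ.>-nonZero (ℕ.>-nonZero⁻¹ b))}}
    σ≡ : σ b x ≡ + g * σ d n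
    σ≡ = trans (cong₂ σ b≡ (trans (sym num) (*-comm n (+ g)))) (σ-scale g d n)
    lem : ∀ s g d → s * (+ 2 * (g * d)) ≡ g * s * (+ 2 * d)
    lem = solve-∀
    scale : b ≡ g ℕ.* d → σ d n ℚᵘ./ (2 ℕ.* d) ≃ σ b x ℚᵘ./ (2 ℕ.* b)
    scale b≡ = ≃-cross (begin
      σ d n * + (2 ℕ.* b)              ≡⟨ cong (λ w → σ d n * w) (trans (pos-* 2 b) (cong (λ w → + 2 * w) (trans (cong +_ b≡) (pos-* g d)))) ⟩
      σ d n * (+ 2 * (+ g * + d))      ≡⟨ lem (σ d n) (+ g) (+ d) ⟩
      + g * σ d n * (+ 2 * + d)        ≡⟨ cong₂ _*_ (sym σ≡) (sym (pos-* 2 d)) ⟩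
      σ b x * + (2 ℕ.* d)              ∎)

module _ (a : ℤ) (b-1 : ℕ) where
  private
    b = suc b-1
    e = 2 ℕ.* b ℕ.* (2 ℕ.* b)
    term : ℕ → ℤ
    term i = σ b (+ suc i) * σ b (a * + suc i)

  sumFrom1-term : ∀ n → toℚᵘ (sumFrom1 n (λ j → saw (+ j / b) ℚ.* saw ((a * + j) / b))) ≃ ∑ n term ℚᵘ./ e
  sumFrom1-term zero    = *≡* refl
  sumFrom1-term (suc n) = begin≃
    toℚᵘ (s′ ℚ.+ u ℚ.* v)
      ≈⟨ toℚᵘ-homo-+ s′ (u ℚ.* v) ⟩
    toℚᵘ s′ ℚᵘ.+ toℚᵘ (u ℚ.* v)
      ≈⟨ ℚᵘ.+-cong (sumFrom1-term n) (toℚᵘ-homo-* u v) ⟩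
    ∑ n term ℚᵘ./ e ℚᵘ.+ toℚᵘ u ℚᵘ.* toℚᵘ v
      ≈⟨ ℚᵘ.+-congʳ (∑ n term ℚᵘ./ e) (ℚᵘ.*-cong (saw-/ (+ suc n) b) (saw-/ (a * + suc n) b)) ⟩
    ∑ n term ℚᵘ./ e ℚᵘ.+ term n ℚᵘ./ e
      ≈⟨ *≡* (trans (lem (∑ n term) (term n) (+ e)) (cong (λ w → (∑ n term + term n) * w) (sym (pos-* e e)))) ⟩
    ∑ (suc n) term ℚᵘ./ e ∎≃
    where
    open ℚᵘ.≃-Reasoning using (step-≈-⟩) renaming (begin_ to begin≃_; _∎ to _∎≃)
    u = saw (+ suc n / b)
    v = saw ((a * + suc n) / b)
    s′ = sumFrom1 n (λ j → saw (+ j / b) ℚ.* saw ((a * + j) / b))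
    lem : ∀ x y e → (x * e + y * e) * e ≡ (x + y) * (e * e)
    lem = solve-∀

  -- The sum in `s` runs over 1, ..., b and that in `D` over 0, ..., b - 1; periodicity makes them
  -- equal.
  ∑term : ∑ b term ≡ D 1ℤ a b
  ∑term = begin
    ∑ b term                                   ≡⟨ ∑-cong b (λ i → cong₂ (λ x y → σ b x * σ b (a * y)) (eq i) (+-comm 1ℤ (+ i))) ⟩
    ∑ b (λ i → F (+ i + 1ℤ))                   ≡⟨ ∑-shift {F = F} per 1ℤ ⟩
    D 1ℤ a b                                   ∎
    where
    F : ℤ → ℤ
    F x = σ b (1ℤ * x) * σ b (a * x)
    eq : ∀ i → + suc i ≡ 1ℤ * (+ i + 1ℤ)
    eq i = trans (+-comm 1ℤ (+ i)) (sym (*-identityˡ (+ i + 1ℤ)))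
    lem : ∀ y x z c → y * (x + z * c) ≡ y * x + y * z * c
    lem = solve-∀
    per₁ : ∀ y x z → σ b (y * (x + z * + b)) ≡ σ b (y * x)
    per₁ y x z = trans (cong (σ b) (lem y x z (+ b))) (σ-periodic b (y * x) (y * z))
    per : Periodic b F
    per x z = cong₂ _*_ (per₁ 1ℤ x z) (per₁ a x z)

  S≃ : toℚᵘ (S a b) ≃ (+ 12 * D 1ℤ a b) ℚᵘ./ e
  S≃ = begin≃
    toℚᵘ (S a b)                              ≈⟨ toℚᵘ-homo-* (+ 12 / 1) (s a b) ⟩
    toℚᵘ (+ 12 / 1) ℚᵘ.* toℚᵘ (s a b)         ≈⟨ ℚᵘ.*-cong (toℚᵘ-/ (+ 12) 1) (sumFrom1-term b) ⟩
    mkℚᵘ (+ 12) 0 ℚᵘ.* (∑ b term ℚᵘ./ e)      ≈⟨ ≃-cross (cong₂ (λ x n → + 12 * x * + n) ∑term (sym (ℕ.+-identityʳ e))) ⟩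
    (+ 12 * D 1ℤ a b) ℚᵘ./ e                  ∎≃
    where
    open ℚᵘ.≃-Reasoning using (step-≈-⟩) renaming (begin_ to begin≃_; _∎ to _∎≃)

  private
    e≡ : + e ≡ + 4 * (+ b * + b)
    e≡ = trans (pos-* (2 ℕ.* b) (2 ℕ.* b)) (trans (cong (λ w → w * w) (pos-* 2 b)) (lem (+ b)))
      where
      lem : ∀ b → + 2 * b * (+ 2 * b) ≡ + 4 * (b * b)
      lem = solve-∀
    lem₁ : ∀ k c → + 4 * (k * c) ≡ k * (+ 4 * c)
    lem₁ = solve-∀
    lem₂ : ∀ q x → + 12 * x * q ≡ + 4 * (q * (+ 3 * x))
    lem₂ = solve-∀

  k/q≡S⇒ : ∀ k q .{{_ : NonZero q}} → k / q ≡ S a b → k * (+ b * + b) ≡ + q * (+ 3 * D 1ℤ a b)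
  k/q≡S⇒ k q@(suc _) eq = *-cancelˡ-≡ (+ 4) _ _ (begin
    + 4 * (k * (+ b * + b))             ≡⟨ lem₁ k (+ b * + b) ⟩
    k * (+ 4 * (+ b * + b))             ≡⟨ cong (λ w → k * w) (sym e≡) ⟩
    k * + e                             ≡⟨ ℚᵘ.drop-*≡* (ℚᵘ.≃-trans (ℚᵘ.≃-sym (toℚᵘ-/ k q)) (ℚᵘ.≃-trans (toℚᵘ-cong eq) S≃)) ⟩
    + 12 * D 1ℤ a b * + q               ≡⟨ lem₂ (+ q) (D 1ℤ a b) ⟩
    + 4 * (+ q * (+ 3 * D 1ℤ a b))      ∎)

  k/q≡S⇐ : ∀ k q .{{_ : NonZero q}} → k * (+ b * + b) ≡ + q * (+ 3 * D 1ℤ a b) → k / q ≡ S a b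
  k/q≡S⇐ k q@(suc _) eq = toℚᵘ-injective (ℚᵘ.≃-trans (toℚᵘ-/ k q) (ℚᵘ.≃-trans (≃-cross (begin
    k * + e                             ≡⟨ cong (λ w → k * w) e≡ ⟩
    k * (+ 4 * (+ b * + b))             ≡⟨ sym (lem₁ k (+ b * + b)) ⟩
    + 4 * (k * (+ b * + b))             ≡⟨ cong (λ w → + 4 * w) eq ⟩
    + 4 * (+ q * (+ 3 * D 1ℤ a b))      ≡⟨ sym (lem₂ (+ q) (D 1ℤ a b)) ⟩
    + 12 * D 1ℤ a b * + q               ∎)) (ℚᵘ.≃-sym S≃)))

value⇒integral : ∀ k q .{{_ : NonZero q}} → IsDedekindValue (k / q) → IntegralValue q k
value⇒integral k q (a , b@(suc b-1) , b≢0 , a⊥b , eq) = a , b , b≢0 , Coprime-∣∣⇒⊥ a a⊥b , k/q≡S⇒ a b-1 k q eq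

integral⇒value : ∀ k q .{{_ : NonZero q}} → IntegralValue q k → IsDedekindValue (k / q)
integral⇒value k q (a , b@(suc b-1) , b≢0 , a⊥b , eq) = a , b , b≢0 , ⊥⇒Coprime a⊥b , k/q≡S⇐ a b-1 k q eq

theorem1 : (q : ℕ) → .{{_ : NonZero q}} → (k : ℤ) → Coprime ∣ k ∣ q →
    IsDedekindValue (k / q) →
    (k′ : ℤ) → + ((q ℕ.* q ℕ.∸ 1) ℕ.* q) ∣ (k′ - k) →
    IsDedekindValue (k′ / q)
theorem1 q k k⊥q value k′ modulus∣ with ∣ᵤ⇒∣ {+ ((q ℕ.* q ℕ.∸ 1) ℕ.* q)} {k′ - k} modulus∣
... | divides z eq = integral⇒value k′ q (subst (IntegralValue q) (sym k′≡)
        (value-translate q (Coprime-∣∣⇒⊥ k k⊥q) (value⇒integral k q value) z))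
  where
  -- The truncated subtraction is a true one because q² is at least 1.
  modulus≡ : + ((q ℕ.* q ℕ.∸ 1) ℕ.* q) ≡ + q * (+ q * + q - 1ℤ)
  modulus≡ = begin
    + ((q ℕ.* q ℕ.∸ 1) ℕ.* q)          ≡⟨ pos-* (q ℕ.* q ℕ.∸ 1) q ⟩
    + (q ℕ.* q ℕ.∸ 1) * + q            ≡⟨ cong (_* + q) (sym (pos-∸ (ℕ.>-nonZero⁻¹ (q ℕ.* q) {{ℕ.m*n≢0 q q}}))) ⟩
    (+ (q ℕ.* q) - 1ℤ) * + q           ≡⟨ cong (λ w → (w - 1ℤ) * + q) (pos-* q q) ⟩
    (+ q * + q - 1ℤ) * + q             ≡⟨ *-comm (+ q * + q - 1ℤ) (+ q) ⟩
    + q * (+ q * + q - 1ℤ)             ∎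
  lem : ∀ k k′ → k′ ≡ k + (k′ - k)
  lem = solve-∀
  k′≡ : k′ ≡ k + z * (+ q * (+ q * + q - 1ℤ))
  k′≡ = trans (lem k k′) (cong (λ w → k + w) (trans eq (cong (λ w → z * w) modulus≡)))
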